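{- Let $\delta\ge3$ be an integer such that $\delta=q-1$ for some prime power $q$. Then there exist a constant $C$ (depending only on $\delta$) and infinitely many connected $C_4$-free graphs $G$ of minimum degree at least $\delta$ such that, writing $n$ for the order of $G$, \[\left|\rho(G)-\frac52\cdot\frac{n}{\delta^2+3\delta+2}\right|\le C\quad\text{and}\quad\left|\pi(G)-\frac54\cdot\frac{n}{\delta^2+3\delta+2}\right|\le C.\]
   Context: $C_4$-free means containing no 4-cycle as a subgraph. For a connected graph $G$ of order $n\ge2$ and vertex $v$, $\overline{\sigma}(v)=\frac{1}{n-1}\sum_w d(v,w)$; the remoteness is $\rho(G)=\max_v\overline{\sigma}(v)$ and the proximity is $\pi(G)=\min_v\overline{\sigma}(v)$. -}

module Defs where

open import Data.Nat as ℕ using (ℕ; zero; suc; _+_; _*_; _∸_; _^_; _≤_; _<_)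
open import Data.Nat.Primality using (Prime)
open import Data.Fin using (Fin; zero; suc)
open import Data.Bool using (Bool; true; false)
open import Data.List using (List; []; _∷_; map; filter; length; foldr)
open import Data.Nat.ListAction using (sum)
open import Data.List.Base using (allFin)
open import Data.Product using (Σ; ∃; _×_; _,_)
open import Data.Empty using (⊥)
open import Relation.Nullary using (¬_)
open import Relation.Binary.PropositionalEquality using (_≡_; _≢_)
open import Data.Bool.Properties using () renaming (_≟_ to _≟ᵇ_)
open import Data.Integer using (+_)
open import Data.Rational using (ℚ; _/_) renaming (_⊔_ to _⊔ℚ_; _⊓_ to _⊓ℚ_)

IsPrimePower : ℕ → Set
IsPrimePower q = Σ ℕ λ p → Σ ℕ λ k → Prime p × 1 ≤ k × q ≡ p ^ k

record Graph (n : ℕ) : Set where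
  field
    adj   : Fin n → Fin n → Bool
    sym   : ∀ u v → adj u v ≡ adj v u
    irrefl : ∀ v → adj v v ≡ false
open Graph public

Adj : ∀ {n} → Graph n → Fin n → Fin n → Set
Adj G u v = adj G u v ≡ true

degree : ∀ {n} → Graph n → Fin n → ℕ
degree G v = length (filter (λ w → adj G v w ≟ᵇ true) (allFin _))

MinDegreeAtLeast : ∀ {n} → Graph n → ℕ → Set
MinDegreeAtLeast G δ = ∀ v → δ ≤ degree G v

C4Free : ∀ {n} → Graph n → Set
C4Free G = ∀ a b c d →
  a ≢ b → a ≢ c → a ≢ d → b ≢ c → b ≢ d → c ≢ d →
  ¬ (Adj G a b × Adj G b c × Adj G c d × Adj G d a)

data Walk {n} (G : Graph n) : Fin n → Fin n → ℕ → Set where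
  here : ∀ v → Walk G v v 0
  step : ∀ {u v w k} → Adj G u v → Walk G v w k → Walk G u w (suc k)

Connected : ∀ {n} → Graph n → Set
Connected G = ∀ u v → ∃ λ k → Walk G u v k

IsDistance : ∀ {n} → Graph n → (Fin n → Fin n → ℕ) → Set
IsDistance G d = ∀ u v → Walk G u v (d u v) × (∀ k → Walk G u v k → d u v ≤ k)

-- For a graph of order n = 2 + m with distance function d:
-- average distance  σ̄(v) = (1/(n-1)) Σ_w d(v,w)
avgDist : ∀ m → (Fin (2 + m) → Fin (2 + m) → ℕ) → Fin (2 + m) → ℚ
avgDist m d v = (+ sum (map (d v) (allFin (2 + m)))) / (suc m)

remoteness : ∀ m → (Fin (2 + m) → Fin (2 + m) → ℕ) → ℚ
remoteness m d = foldr _⊔ℚ_ (avgDist m d zero) (map (avgDist m d) (allFin (2 + m)))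

proximity : ∀ m → (Fin (2 + m) → Fin (2 + m) → ℕ) → ℚ
proximity m d = foldr _⊓ℚ_ (avgDist m d zero) (map (avgDist m d) (allFin (2 + m)))

{-# OPTIONS --safe #-}
module Submission where

-- Let q = δ + 1.  The polarity graph of PG(2, q) minus an absolute point has as
-- vertices the q slopes m and the q² affine points (a , b), with m adjacent to
-- (m , b) and (a , b) adjacent to (c , ac - b).  It is C₄-free, has
-- q² + q = δ² + 3δ + 2 vertices and minimum degree at least q.  Deleting the
-- edges between the columns a = 0 and a = 1 costs a vertex at most one neighbour
-- and puts the slopes 0 and 1 at distance exactly 4.  Link 2L + 1 copies into a
-- chain, each by a bridge from its slope 1 to the slope 0 of the next copy.  As
-- a 1-Lipschitz potential shows, vertices in copies i and j are at distance
-- 5 ∣ i - j ∣ up to a constant.  Hence the average distance is extremal, up to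
-- a constant, at an end of the chain and in its middle.
--
-- The field with q = p ^ k elements: adjoining roots of X ^ q - X to ℤ/p, without
-- asking for irreducibility, gives a finite ring over which the polynomial splits.
-- A maximal ideal is found by running through the ring's elements.  Modulo it the
-- q roots are distinct, as the derivative is - 1, and they are closed under
-- ac - b by the Frobenius homomorphism.

-- Why the block looks as it does. The absolute point at infinity is the only common neighbour of
-- the slopes 0 and 1, so removing it pushes them to distance 3. Every remaining path of length 3
-- runs through an edge between the columns 0 and 1, so deleting these edges gives distance 4. The
-- price in degree is affordable: an affine point starts with q + 1 polar points, loses itself if it
-- is absolute and one more if it lies in column 0 or 1, and keeps at least q - 1 = δ neighbours.
-- With the link, each block adds 5 to a distance. From an end of a chain of K blocks the average
-- distance is thus about 5K/2 and from the middle about 5K/4, with K = n / (q² + q); these are the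
-- coefficients of the theorem.
--
-- On the algebraic side, splitting X ^ q - X without irreducible factors may produce zero divisors.
-- Then the listed roots need be neither distinct nor all the roots, so a maximal ideal has to be
-- divided out afterwards. Finiteness and decidable equality, which every adjunction preserves, are
-- what make the choice of that ideal effective.

module FiniteFields where

  open import Level using (0ℓ)
  open import Algebra.Bundles using (CommutativeRing)
  import Algebra.Properties.CommutativeSemiring.Binomial as BinomialTheorem
  import Algebra.Properties.CommutativeSemiring.Exp as Exp
  import Algebra.Properties.Ring as RingProps
  import Algebra.Properties.Semiring.Mult as Mult
  import Algebra.Properties.Semiring.Sum as Sum
  import Algebra.Solver.Ring.NaturalCoefficients.Default as Solver
  open import Data.Empty using (⊥-elim)
  open import Data.Fin as Fin using (Fin; zero; suc; toℕ; inject₁; fromℕ)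
  import Data.Fin.Properties as Finₚ
  open import Data.Integer as ℤ using (ℤ)
  import Data.Integer.DivMod as ℤᵈᵐ
  import Data.Integer.Divisibility.Signed as ℤᵈ
  import Data.Integer.Properties as ℤₚ
  open import Data.List as List using (List; []; _∷_; upTo; cartesianProductWith)
  import Data.List.Membership.Propositional.Properties as ∈ₚ
  open import Data.List.Relation.Unary.All as All using (All; []; _∷_)
  open import Data.List.Relation.Unary.Any as Any using (Any; here; any?)
  import Data.List.Relation.Unary.Any.Properties as Anyₚ
  open import Data.Nat as ℕ using (ℕ; zero; suc; z≤n; s≤s; _!)
  open import Data.Nat.Combinatorics using (_C_; nCn≡1; nCk≡n!/k![n-k]!; k![n∸k]!∣n!)
  import Data.Nat.Divisibility as ℕᵈ
  import Data.Nat.DivMod as ℕᵈᵐ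
  open import Data.Nat.Primality using (Prime; euclidsLemma; prime⇒nonTrivial; prime⇒nonZero)
  import Data.Nat.Properties as ℕₚ
  open import Data.Nat.Properties using (_!*_!≢0)
  open import Data.Product using (Σ; ∃; _×_; _,_; proj₁; proj₂)
  open import Data.Sum as Sum⊎ using (_⊎_; inj₁; inj₂)
  open import Function using (_∘_; const)
  open import Relation.Nullary using (¬_; Dec; yes; no)
  open import Relation.Nullary.Decidable using (map′)
  open import Relation.Binary.PropositionalEquality as ≡ using (_≡_)
  import Relation.Binary.Reasoning.Setoid as SetoidReasoning
  open import Defs using (IsPrimePower)

  Ring₀ : Set₁
  Ring₀ = CommutativeRing 0ℓ 0ℓ

  -- Ideals and quotients of commutative rings.

  record Ideal (R : Ring₀) : Set₁ where
    open CommutativeRing R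
    field
      Mem      : Carrier → Set
      Mem-resp : ∀ {x y} → x ≈ y → Mem x → Mem y
      Mem-0    : Mem 0#
      Mem-+    : ∀ {x y} → Mem x → Mem y → Mem (x + y)
      Mem-*    : ∀ r {x} → Mem x → Mem (r * x)

  module Quotient (R : Ring₀) (I : Ideal R) where
    open CommutativeRing R
    open RingProps ring
    open Ideal I
    open SetoidReasoning setoid

    infix 4 _~_
    _~_ : Carrier → Carrier → Set
    x ~ y = Mem (x - y)

    ≈⇒~ : ∀ {x y} → x ≈ y → x ~ y
    ≈⇒~ x≈y = Mem-resp (sym (x≈y⇒x∙y⁻¹≈ε x≈y)) Mem-0

    ~-sym : ∀ {x y} → x ~ y → y ~ x
    ~-sym {x} {y} m = Mem-resp (trans (-1*x≈-x _) (⁻¹-anti-homo‿- x y)) (Mem-* (- 1#) m)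

    telescope : ∀ x y z → (x - y) + (y - z) ≈ x - z
    telescope x y z = begin
      (x - y) + (y - z)     ≈⟨ +-assoc x (- y) (y - z) ⟩
      x + (- y + (y - z))   ≈⟨ +-congˡ (+-assoc (- y) y (- z)) ⟨
      x + ((- y + y) - z)   ≈⟨ +-congˡ (+-congʳ (-‿inverseˡ y)) ⟩
      x + (0# - z)          ≈⟨ +-congˡ (+-identityˡ (- z)) ⟩
      x - z                 ∎

    ~-trans : ∀ {x y z} → x ~ y → y ~ z → x ~ z
    ~-trans {x} {y} {z} m n = Mem-resp (telescope x y z) (Mem-+ m n)

    ~-+-congʳ : ∀ {x y} z → x ~ y → x + z ~ y + z
    ~-+-congʳ {x} {y} z m = Mem-resp (begin
      x - y                    ≈⟨ telescope x (- z) y ⟨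
      (x - - z) + (- z - y)    ≈⟨ +-cong (+-congˡ (-‿involutive z)) (trans (-‿+-comm z y) (-‿cong (+-comm z y))) ⟩
      (x + z) - (y + z)        ∎) m

    ~-+-cong : ∀ {x y u v} → x ~ y → u ~ v → x + u ~ y + v
    ~-+-cong {x} {y} {u} {v} m n = ~-trans (~-+-congʳ u m)
      (~-trans (≈⇒~ (+-comm y u)) (~-trans (~-+-congʳ y n) (≈⇒~ (+-comm v y))))

    ~-*-congˡ : ∀ {x y} z → x ~ y → z * x ~ z * y
    ~-*-congˡ {x} {y} z m = Mem-resp (x[y-z]≈xy-xz z x y) (Mem-* z m)

    ~-*-cong : ∀ {x y u v} → x ~ y → u ~ v → x * u ~ y * v
    ~-*-cong {x} {y} {u} {v} m n = ~-trans (≈⇒~ (*-comm x u)) (~-trans (~-*-congˡ u m)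
      (~-trans (≈⇒~ (*-comm u y)) (~-*-congˡ y n)))

    ~-neg-cong : ∀ {x y} → x ~ y → - x ~ - y
    ~-neg-cong {x} {y} m = ~-trans (≈⇒~ (sym (-1*x≈-x x)))
      (~-trans (~-*-congˡ (- 1#) m) (≈⇒~ (-1*x≈-x y)))

    quotient : Ring₀
    quotient = record
      { Carrier = Carrier ; _≈_ = _~_ ; _+_ = _+_ ; _*_ = _*_ ; -_ = -_ ; 0# = 0# ; 1# = 1#
      ; isCommutativeRing = record
        { isRing = record
          { +-isAbelianGroup = record
            { isGroup = record
              { isMonoid = record
                { isSemigroup = record
                  { isMagma = record
                    { isEquivalence = record { refl = ≈⇒~ refl ; sym = ~-sym ; trans = ~-trans }
                    ; ∙-cong = ~-+-cong }
                  ; assoc = λ x y z → ≈⇒~ (+-assoc x y z) }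
                ; identity = (λ x → ≈⇒~ (+-identityˡ x)) , (λ x → ≈⇒~ (+-identityʳ x)) }
              ; inverse = (λ x → ≈⇒~ (-‿inverseˡ x)) , (λ x → ≈⇒~ (-‿inverseʳ x))
              ; ⁻¹-cong = ~-neg-cong }
            ; comm = λ x y → ≈⇒~ (+-comm x y) }
          ; *-cong = ~-*-cong
          ; *-assoc = λ x y z → ≈⇒~ (*-assoc x y z)
          ; *-identity = (λ x → ≈⇒~ (*-identityˡ x)) , (λ x → ≈⇒~ (*-identityʳ x))
          ; distrib = (λ x y z → ≈⇒~ (distribˡ x y z)) , (λ x y z → ≈⇒~ (distribʳ x y z)) }
        ; *-comm = λ x y → ≈⇒~ (*-comm x y) } }

  -- Finite rings and their maximal ideals.

  record FiniteRing : Set₁ where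
    field
      commutativeRing : Ring₀
    open CommutativeRing commutativeRing hiding (zero) public
    field
      _≟_      : ∀ x y → Dec (x ≈ y)
      elements : List Carrier
      -- Completeness holds up to `_≈_` only: elements will be integers taken modulo p, and
      -- coefficient functions compared pointwise.
      complete : ∀ x → Any (x ≈_) elements
      1≉0      : ¬ 1# ≈ 0#

    search : {P : Carrier → Set} → (∀ {x y} → x ≈ y → P x → P y) → (∀ x → Dec (P x)) → Dec (∃ P)
    search resp P? = map′ Any.satisfied
      (λ (x , px) → Any.map (λ x≈y → resp x≈y px) (complete x)) (any? P? elements)

  module Maximal (F : FiniteRing) where
    open FiniteRing F
    open RingProps ring
    open SetoidReasoning setoid

    record ProperIdeal : Set₁ where
      field
        ideal  : Ideal commutativeRing
      open Ideal ideal public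
      field
        mem?   : ∀ x → Dec (Mem x)
        proper : ¬ Mem 1#

    open ProperIdeal

    _⊆_ : ProperIdeal → ProperIdeal → Set
    I ⊆ J = ∀ {x} → Mem I x → Mem J x

    UnitMod : ProperIdeal → Carrier → Set
    UnitMod I a = ∃ λ r → Mem I (1# - r * a)

    Decided : ProperIdeal → Carrier → Set
    Decided I a = Mem I a ⊎ UnitMod I a

    -- Both alternatives survive an enlargement of the ideal, so an element once settled stays
    -- settled and a single pass over the ring suffices.
    decided-mono : ∀ I J → I ⊆ J → ∀ {a} → Decided I a → Decided J a
    decided-mono I J I⊆J (inj₁ m)       = inj₁ (I⊆J m)
    decided-mono I J I⊆J (inj₂ (r , m)) = inj₂ (r , I⊆J m)

    zeroIdeal : ProperIdeal
    zeroIdeal = record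
      { ideal = record
        { Mem = _≈ 0# ; Mem-resp = λ x≈y x≈0 → trans (sym x≈y) x≈0 ; Mem-0 = refl
        ; Mem-+ = λ p q → trans (+-cong p q) (+-identityˡ 0#)
        ; Mem-* = λ r p → trans (*-congˡ p) (zeroʳ r) }
      ; mem? = _≟ 0# ; proper = 1≉0 }

    infixl 20 _+⟨_⟩

    _+⟨_⟩ : Ideal commutativeRing → Carrier → Ideal commutativeRing
    I +⟨ a ⟩ = record
      { Mem = λ x → ∃ λ r → M (x - r * a)
      ; Mem-resp = λ x≈y (r , m) → r , resp (+-congʳ x≈y) m
      ; Mem-0 = 0# , resp (sym (trans (+-congˡ (-‿cong (zeroˡ a))) (-‿inverseʳ 0#))) (Ideal.Mem-0 I)
      ; Mem-+ = λ {x} {y} (r , m) (s , n) → r + s , resp (add x y r s) (Ideal.Mem-+ I m n)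
      ; Mem-* = λ t {x} (r , m) → t * r , resp (trans (x[y-z]≈xy-xz t x (r * a)) (+-congˡ (-‿cong (sym (*-assoc t r a))))) (Ideal.Mem-* I t m) }
      where
      open Ideal I using () renaming (Mem to M; Mem-resp to resp)
      open import Algebra.Properties.CommutativeSemigroup +-commutativeSemigroup using (interchange)
      add : ∀ x y r s → (x - r * a) + (y - s * a) ≈ (x + y) - (r + s) * a
      add x y r s = begin
        (x - r * a) + (y - s * a)         ≈⟨ interchange x (- (r * a)) y (- (s * a)) ⟩
        (x + y) + (- (r * a) - s * a)     ≈⟨ +-congˡ (-‿+-comm (r * a) (s * a)) ⟩
        (x + y) - (r * a + s * a)         ≈⟨ +-congˡ (-‿cong (distribʳ a r s)) ⟨
        (x + y) - (r + s) * a             ∎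

    mem+? : ∀ I a x → Dec (Ideal.Mem (ideal I +⟨ a ⟩) x)
    mem+? I a x = search (λ r≈s → Mem-resp I (+-congˡ (-‿cong (*-congʳ r≈s)))) (λ r → mem? I (x - r * a))

    -- If 1 lies in I + (a), then a is already invertible modulo I and I is kept; otherwise I + (a)
    -- is still proper and contains a.
    step : ∀ I a → Σ ProperIdeal λ J → I ⊆ J × Decided J a
    step I a with mem+? I a 1#
    ... | yes unit  = I , (λ m → m) , inj₂ unit
    ... | no ¬unit = record { ideal = ideal I +⟨ a ⟩ ; mem? = mem+? I a ; proper = ¬unit }
        , (λ {x} m → 0# , Mem-resp I (sym (trans (+-congˡ (trans (-‿cong (zeroˡ a)) -0#≈0#)) (+-identityʳ x))) m)
        , inj₁ (1# , Mem-resp I (sym (x≈y⇒x∙y⁻¹≈ε (sym (*-identityˡ a)))) (Mem-0 I))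

    sweep : ∀ I as → Σ ProperIdeal λ J → I ⊆ J × All (Decided J) as
    sweep I []       = I , (λ m → m) , []
    sweep I (a ∷ as) with step I a
    ... | J , I⊆J , d with sweep J as
    ...   | K , J⊆K , ds = K , (λ m → J⊆K (I⊆J m)) , decided-mono J K J⊆K d ∷ ds

    decided-resp : ∀ I {a b} → a ≈ b → Decided I a → Decided I b
    decided-resp I a≈b (inj₁ m)       = inj₁ (Mem-resp I a≈b m)
    decided-resp I a≈b (inj₂ (r , m)) = inj₂ (r , Mem-resp I (+-congˡ (-‿cong (*-congˡ a≈b))) m)

    -- Maximality in the form in which it is used: modulo M every element is zero or invertible.
    maximal : Σ ProperIdeal λ M → ∀ a → Decided M a
    maximal with sweep zeroIdeal elements
    ... | M , _ , ds = M , λ a → All.lookupWith (λ d a≈x → decided-resp M (sym a≈x) d) ds (complete a)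

  multiples : ℤ → Ideal ℤₚ.+-*-commutativeRing
  multiples m = record
    { Mem = m ℤᵈ.∣_ ; Mem-resp = λ { ≡.refl d → d } ; Mem-0 = ℤᵈ.divides (ℤ.+ 0) ≡.refl
    ; Mem-+ = ℤᵈ.∣m∣n⇒∣m+n ; Mem-* = λ r → ℤᵈ.∣n⇒∣m*n r }

  ℤmod : (n : ℕ) → 2 ℕ.≤ n → FiniteRing
  ℤmod n@(suc _) 2≤n = record
    { commutativeRing = Quotient.quotient ℤₚ.+-*-commutativeRing (multiples (ℤ.+ n))
    ; _≟_ = λ x y → (ℤ.+ n) ℤᵈ.∣? (x ℤ.- y)
    ; elements = List.map ℤ.+_ (upTo n)
    ; complete = λ x → Anyₚ.map⁺ (Any.map (λ { ≡.refl → residue x }) (∈ₚ.∈-upTo⁺ (ℤᵈᵐ.n%ℕd<d x n)))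
    ; 1≉0 = λ d → ℕₚ.<⇒≱ 2≤n (ℕᵈ.∣⇒≤ (ℤᵈ.∣⇒∣ᵤ d)) }
    where
    residue : ∀ x → (ℤ.+ n) ℤᵈ.∣ x ℤ.- (ℤ.+ (x ℤᵈᵐ.%ℕ n))
    residue x = ℤᵈ.divides (x ℤᵈᵐ./ℕ n) (≡.trans
      (≡.cong (ℤ._- (ℤ.+ (x ℤᵈᵐ.%ℕ n)))
        (≡.trans (ℤᵈᵐ.a≡a%ℕn+[a/ℕn]*n x n) (ℤₚ.+-comm (ℤ.+ (x ℤᵈᵐ.%ℕ n)) (x ℤᵈᵐ./ℕ n ℤ.* ℤ.+ n))))
      (RingProps.//-rightDividesʳ ℤₚ.+-*-ring (ℤ.+ (x ℤᵈᵐ.%ℕ n)) (x ℤᵈᵐ./ℕ n ℤ.* ℤ.+ n)))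

  -- Ring homomorphisms, monic polynomials and division by X - a.

  record Hom (R S : Ring₀) : Set where
    private
      module R = CommutativeRing R
      module S = CommutativeRing S
    field
      ⟦_⟧    : R.Carrier → S.Carrier
      ⟦⟧-cong : ∀ {x y} → x R.≈ y → ⟦ x ⟧ S.≈ ⟦ y ⟧
      +-homo : ∀ x y → ⟦ x R.+ y ⟧ S.≈ ⟦ x ⟧ S.+ ⟦ y ⟧
      *-homo : ∀ x y → ⟦ x R.* y ⟧ S.≈ ⟦ x ⟧ S.* ⟦ y ⟧
      0-homo : ⟦ R.0# ⟧ S.≈ S.0#
      1-homo : ⟦ R.1# ⟧ S.≈ S.1#

  -- The vector c : Fin n → Carrier stands for the monic polynomial
  -- Xⁿ + c (n-1) Xⁿ⁻¹ + … + c 0.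
  module Monic (R : Ring₀) where
    open CommutativeRing R hiding (zero)
    open SetoidReasoning setoid

    eval : ∀ {n} → (Fin n → Carrier) → Carrier → Carrier
    eval {zero}  c x = 1#
    eval {suc n} c x = c zero + x * eval (c ∘ suc) x

    eval-cong : ∀ {n} {c d : Fin n → Carrier} {x y} → (∀ i → c i ≈ d i) → x ≈ y → eval c x ≈ eval d y
    eval-cong {zero}  e x≈y = refl
    eval-cong {suc n} e x≈y = +-cong (e zero) (*-cong x≈y (eval-cong (λ i → e (suc i)) x≈y))

    -- Synthetic division by X - a: each coefficient of the quotient is the Horner value at a of the
    -- higher coefficients, the leading 1 included.
    quot : ∀ {n} → (Fin (suc n) → Carrier) → Carrier → Fin n → Carrier
    quot c a zero    = eval (c ∘ suc) a
    quot c a (suc i) = quot (c ∘ suc) a i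

    quot-cong : ∀ {n} {c d : Fin (suc n) → Carrier} {x y} → (∀ i → c i ≈ d i) → x ≈ y → ∀ i → quot c x i ≈ quot d y i
    quot-cong e x≈y zero    = eval-cong (λ i → e (suc i)) x≈y
    quot-cong e x≈y (suc i) = quot-cong (λ j → e (suc j)) x≈y i

    -- Roots are peeled off one by one, each from the quotient left by its predecessors. This
    -- accounts for multiplicities without forming a product of linear factors; degree 0 imposes
    -- nothing.
    Splits : ∀ {n} → (Fin n → Carrier) → (Fin n → Carrier) → Set
    Splits {zero}  c a = 1# ≈ 1#
    Splits {suc n} c a = eval c (a zero) ≈ 0# × Splits (quot c (a zero)) (a ∘ suc)

    Splits-cong : ∀ {n} {c d : Fin n → Carrier} a → (∀ i → c i ≈ d i) → Splits c a → Splits d a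
    Splits-cong {zero}  a e s       = s
    Splits-cong {suc n} a e (r , s) =
      trans (sym (eval-cong e refl)) r , Splits-cong (a ∘ suc) (quot-cong e refl) s

  -- Adjoining a root of a monic polynomial to a finite ring.

  module Adjoin (F : FiniteRing) {m : ℕ} (c : Fin (suc m) → FiniteRing.Carrier F) where
    open FiniteRing F
    open RingProps ring
    open SetoidReasoning setoid
    open Solver commutativeSemiring using (solve; _:+_; _:*_; _:=_)

    -- Coordinates in the basis 1, X, ..., X^m of the polynomials modulo c, which is monic of degree
    -- m + 1.
    V : Set
    V = Fin (suc m) → Carrier

    infix 4 _≋_
    _≋_ : V → V → Set
    u ≋ v = ∀ i → u i ≈ v i

    infixl 6 _⊕_
    _⊕_ : V → V → V
    (u ⊕ v) i = u i + v i

    infixr 7 _•_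
    _•_ : Carrier → V → V
    (r • v) i = r * v i

    𝟘 e₀ : V
    𝟘 i = 0#
    e₀ zero    = 1#
    e₀ (suc i) = 0#

    ≋-refl : ∀ {u} → u ≋ u
    ≋-refl i = refl
    ≋-sym : ∀ {u v} → u ≋ v → v ≋ u
    ≋-sym p i = sym (p i)
    ≋-trans : ∀ {u v w} → u ≋ v → v ≋ w → u ≋ w
    ≋-trans p q i = trans (p i) (q i)
    ⊕-cong : ∀ {u v w x} → u ≋ v → w ≋ x → u ⊕ w ≋ v ⊕ x
    ⊕-cong p q i = +-cong (p i) (q i)

    up : V → V
    up v zero    = 0#
    up v (suc i) = v (inject₁ i)

    top : V → Carrier
    top v = v (fromℕ m)

    -- Multiplication by the adjoined root: x · x^m = - c.
    X : V → V
    X v i = up v i + top v * - c i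

    X-cong : ∀ {u v} → u ≋ v → X u ≋ X v
    X-cong p zero    = +-congˡ (*-congʳ (p _))
    X-cong p (suc i) = +-cong (p _) (*-congʳ (p _))

    X-⊕ : ∀ u v → X (u ⊕ v) ≋ X u ⊕ X v
    X-⊕ u v zero    = begin
      0# + (top u + top v) * - c zero                       ≈⟨ +-congʳ (+-identityˡ 0#) ⟨
      (0# + 0#) + (top u + top v) * - c zero                ≈⟨ solve 5 (λ a b s t d → (a :+ b) :+ (s :+ t) :* d := (a :+ s :* d) :+ (b :+ t :* d))
                                                                   refl 0# 0# (top u) (top v) (- c zero) ⟩
      (0# + top u * - c zero) + (0# + top v * - c zero)     ∎
    X-⊕ u v (suc i) = solve 5 (λ a b s t d → (a :+ b) :+ (s :+ t) :* d := (a :+ s :* d) :+ (b :+ t :* d)) refl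
      (u (inject₁ i)) (v (inject₁ i)) (top u) (top v) (- c (suc i))

    X-• : ∀ r v → X (r • v) ≋ r • X v
    X-• r v zero    = begin
      0# + (r * top v) * - c zero         ≈⟨ +-cong (sym (zeroʳ r)) (*-assoc r _ _) ⟩
      r * 0# + r * (top v * - c zero)     ≈⟨ distribˡ r _ _ ⟨
      r * (0# + top v * - c zero)         ∎
    X-• r v (suc i) = solve 4 (λ r a t d → r :* a :+ (r :* t) :* d := r :* (a :+ t :* d)) refl
      r (v (inject₁ i)) (top v) (- c (suc i))

    X-𝟘 : X 𝟘 ≋ 𝟘
    X-𝟘 zero    = trans (+-identityˡ _) (zeroˡ _)
    X-𝟘 (suc i) = trans (+-identityˡ _) (zeroˡ _)

    -- The polynomial a evaluated at the operator `X` by Horner's scheme and applied to b. The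
    -- number k of coefficients is free, so that induction can drop the lowest one.
    act : ∀ {k} → (Fin k → Carrier) → V → V
    act {zero}  a b = 𝟘
    act {suc k} a b = a zero • b ⊕ X (act (a ∘ suc) b)

    act-cong : ∀ {k} {a a′ : Fin k → Carrier} {b b′} → (∀ i → a i ≈ a′ i) → b ≋ b′ → act a b ≋ act a′ b′
    act-cong {zero}  p q = ≋-refl
    act-cong {suc k} p q = ⊕-cong (λ i → *-cong (p zero) (q i)) (X-cong (act-cong (λ i → p (suc i)) q))

    act-⊕ʳ : ∀ {k} (a : Fin k → Carrier) u v → act a (u ⊕ v) ≋ act a u ⊕ act a v
    act-⊕ʳ {zero}  a u v i = sym (+-identityˡ 0#)
    act-⊕ʳ {suc k} a u v i = begin
      a zero * (u i + v i) + X (act a′ (u ⊕ v)) i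
        ≈⟨ +-congˡ (trans (X-cong (act-⊕ʳ a′ u v) i) (X-⊕ (act a′ u) (act a′ v) i)) ⟩
      a zero * (u i + v i) + (X (act a′ u) i + X (act a′ v) i)
        ≈⟨ solve 5 (λ r u v x y → r :* (u :+ v) :+ (x :+ y) := (r :* u :+ x) :+ (r :* v :+ y)) refl (a zero) (u i) (v i) (X (act a′ u) i) (X (act a′ v) i) ⟩
      (a zero * u i + X (act a′ u) i) + (a zero * v i + X (act a′ v) i) ∎
      where
      a′ : Fin k → Carrier
      a′ = a ∘ suc

    act-•ʳ : ∀ {k} (a : Fin k → Carrier) r v → act a (r • v) ≋ r • act a v
    act-•ʳ {zero}  a r v i = sym (zeroʳ r)
    act-•ʳ {suc k} a r v i = begin
      a zero * (r * v i) + X (act a′ (r • v)) i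
        ≈⟨ +-congˡ (trans (X-cong (act-•ʳ a′ r v) i) (X-• r (act a′ v) i)) ⟩
      a zero * (r * v i) + r * X (act a′ v) i
        ≈⟨ solve 4 (λ s r v x → s :* (r :* v) :+ r :* x := r :* (s :* v :+ x)) refl (a zero) r (v i) (X (act a′ v) i) ⟩
      r * (a zero * v i + X (act a′ v) i) ∎
      where
      a′ : Fin k → Carrier
      a′ = a ∘ suc

    act-X : ∀ {k} (a : Fin k → Carrier) v → act a (X v) ≋ X (act a v)
    act-X {zero}  a v = ≋-sym X-𝟘
    act-X {suc k} a v = ≋-trans
      (⊕-cong (≋-sym (X-• (a zero) v)) (X-cong (act-X (a ∘ suc) v)))
      (≋-sym (X-⊕ (a zero • v) (X (act (a ∘ suc) v))))

    act-𝟘 : ∀ {k} (a : Fin k → Carrier) → act a 𝟘 ≋ 𝟘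
    act-𝟘 {zero}  a   = ≋-refl
    act-𝟘 {suc k} a i = trans (+-cong (zeroʳ _) (trans (X-cong (act-𝟘 (a ∘ suc)) i) (X-𝟘 i))) (+-identityˡ 0#)

    -- Induction on b: `act a` is linear and commutes with `X`, so it passes through every Horner
    -- step.
    act-comm : ∀ {k l} (a : Fin k → Carrier) (b : Fin l → Carrier) v → act a (act b v) ≋ act b (act a v)
    act-comm {l = zero}  a b v = act-𝟘 a
    act-comm {l = suc l} a b v = ≋-trans (act-⊕ʳ a (b zero • v) (X (act (b ∘ suc) v)))
      (⊕-cong (act-•ʳ a (b zero) v)
        (≋-trans (act-X a (act (b ∘ suc) v)) (X-cong (act-comm a (b ∘ suc) v))))

    ext : ∀ {k} → (Fin k → Carrier) → ℕ → Carrier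
    ext {zero}  a i       = 0#
    ext {suc k} a zero    = a zero
    ext {suc k} a (suc i) = ext (a ∘ suc) i

    ext-≥ : ∀ {k} (a : Fin k → Carrier) {i} → k ℕ.≤ i → ext a i ≈ 0#
    ext-≥ {zero}  a k≤i       = refl
    ext-≥ {suc k} a (s≤s k≤i) = ext-≥ (a ∘ suc) k≤i

    ext-toℕ : ∀ {k} (a : Fin k → Carrier) i → ext a (toℕ i) ≈ a i
    ext-toℕ a zero    = refl
    ext-toℕ a (suc i) = ext-toℕ (a ∘ suc) i

    -- With at most m + 1 coefficients, the vector to which `X` is applied always has top coordinate
    -- 0. No reduction modulo c takes place and `X` is a plain shift.
    act-e₀ : ∀ {k} (a : Fin k → Carrier) → k ℕ.≤ suc m → ∀ i → act a e₀ i ≈ ext a (toℕ i)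
    act-e₀ {zero}  a k≤ i = refl
    act-e₀ {suc k} a (s≤s k≤m) i = begin
      a zero * e₀ i + (up w i + top w * - c i)
        ≈⟨ +-congˡ (+-congˡ (*-congʳ top-w)) ⟩
      a zero * e₀ i + (up w i + 0# * - c i)
        ≈⟨ +-congˡ (trans (+-congˡ (zeroˡ _)) (+-identityʳ _)) ⟩
      a zero * e₀ i + up w i
        ≈⟨ coefficient i ⟩
      ext a (toℕ i) ∎
      where
      w : V
      w = act (a ∘ suc) e₀
      IH : ∀ j → w j ≈ ext (a ∘ suc) (toℕ j)
      IH = act-e₀ (a ∘ suc) (ℕₚ.m≤n⇒m≤1+n k≤m)
      top-w : top w ≈ 0#
      top-w = trans (IH (fromℕ m)) (ext-≥ (a ∘ suc) (≡.subst (k ℕ.≤_) (≡.sym (Finₚ.toℕ-fromℕ m)) k≤m))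
      coefficient : ∀ j → a zero * e₀ j + up w j ≈ ext a (toℕ j)
      coefficient zero    = trans (+-identityʳ _) (*-identityʳ _)
      coefficient (suc j) = trans (trans (+-congʳ (zeroʳ _)) (+-identityˡ _))
        (trans (IH (inject₁ j)) (reflexive (≡.cong (ext (a ∘ suc)) (Finₚ.toℕ-inject₁ j))))

    -- The operators act a are polynomials in X and hence commute, and act a e₀ = a:
    -- the ring laws follow from these two facts.
    infixl 7 _⊗_
    _⊗_ : V → V → V
    a ⊗ b = act a b

    ⊗-identityʳ : ∀ a → a ⊗ e₀ ≋ a
    ⊗-identityʳ a i = trans (act-e₀ a ℕₚ.≤-refl i) (ext-toℕ a i)

    ⊗-comm : ∀ a b → a ⊗ b ≋ b ⊗ a
    ⊗-comm a b = ≋-trans (act-cong {a = a} (λ _ → refl) (≋-sym (⊗-identityʳ b)))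
      (≋-trans (act-comm a b e₀) (act-cong {a = b} (λ _ → refl) (⊗-identityʳ a)))

    ⊗-congˡ : ∀ a {u v} → u ≋ v → a ⊗ u ≋ a ⊗ v
    ⊗-congˡ a = act-cong {a = a} (λ _ → refl)

    ⊗-assoc : ∀ a b d → (a ⊗ b) ⊗ d ≋ a ⊗ (b ⊗ d)
    ⊗-assoc a b d = ≋-trans (⊗-comm (a ⊗ b) d)
      (≋-trans (act-comm d a b) (⊗-congˡ a (⊗-comm d b)))

    vectors : ∀ k → List (Fin k → Carrier)
    vectors zero    = (λ ()) ∷ []
    vectors (suc k) = cartesianProductWith (λ { r v zero → r ; r v (suc i) → v i }) elements (vectors k)

    vectors-complete : ∀ k (v : Fin k → Carrier) → Any (λ u → ∀ i → v i ≈ u i) (vectors k)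
    vectors-complete zero    v = here (λ ())
    vectors-complete (suc k) v = Anyₚ.cartesianProductWith⁺ _ (λ { p q zero → p ; p q (suc i) → q i })
      (complete (v zero)) (vectors-complete k (v ∘ suc))

    distribˡ-⊗ : ∀ u v w → u ⊗ (v ⊕ w) ≋ u ⊗ v ⊕ u ⊗ w
    distribˡ-⊗ = act-⊕ʳ

    extension : FiniteRing
    extension = record
      { commutativeRing = record
        { Carrier = V ; _≈_ = _≋_ ; _+_ = _⊕_ ; _*_ = _⊗_ ; -_ = λ v i → - v i ; 0# = 𝟘 ; 1# = e₀
        ; isCommutativeRing = record
          { isRing = record
            { +-isAbelianGroup = Pointwise.isAbelianGroup +-isAbelianGroup
            ; *-cong = λ {a} {a′} {b} {b′} p q → act-cong {a = a} {a′} p q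
            ; *-assoc = ⊗-assoc
            ; *-identity = (λ a → ≋-trans (⊗-comm e₀ a) (⊗-identityʳ a)) , ⊗-identityʳ
            ; distrib = distribˡ-⊗ , λ u v w → ≋-trans (⊗-comm (v ⊕ w) u)
                (≋-trans (distribˡ-⊗ u v w) (⊕-cong (⊗-comm u v) (⊗-comm u w))) }
          ; *-comm = ⊗-comm } }
      ; _≟_ = λ u v → Finₚ.all? (λ i → u i ≟ v i)
      ; elements = vectors (suc m)
      ; complete = vectors-complete (suc m)
      -- Coordinate 0 separates `e₀` from `𝟘`, so the extension is nontrivial whether or not c is
      -- irreducible.
      ; 1≉0 = λ p → 1≉0 (p zero) }
      where
      import Algebra.Construct.Pointwise (Fin (suc m)) as Pointwise

    embed : Hom commutativeRing (FiniteRing.commutativeRing extension)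
    embed = record
      { ⟦_⟧ = _• e₀
      ; ⟦⟧-cong = λ p i → *-congʳ p
      ; +-homo = λ x y i → distribʳ (e₀ i) x y
      ; *-homo = λ x y i → sym (trans (act-•ʳ (x • e₀) y e₀ i) (trans (*-congˡ (⊗-identityʳ (x • e₀) i))
          (trans (sym (*-assoc y x _)) (*-congʳ (*-comm y x)))))
      ; 0-homo = λ i → zeroˡ (e₀ i)
      ; 1-homo = λ i → *-identityˡ (e₀ i) }

    root : V
    root = X e₀

    root-⊗ : ∀ v → root ⊗ v ≋ X v
    root-⊗ v = ≋-trans (⊗-comm root v) (≋-trans (act-X v e₀) (X-cong (⊗-identityʳ v)))

    X^ : ℕ → V
    X^ zero    = e₀
    X^ (suc k) = X (X^ k)

    module E = Monic (FiniteRing.commutativeRing extension)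

    -- The summand `X^ k` is the monic leading term, which `act` leaves out.
    eval-root : ∀ {k} (a : Fin k → Carrier) → E.eval (λ i → a i • e₀) root ≋ act a e₀ ⊕ X^ k
    eval-root {zero}  a i = sym (+-identityˡ _)
    eval-root {suc k} a i = begin
      a zero * e₀ i + (root ⊗ E.eval (λ j → a (suc j) • e₀) root) i
        ≈⟨ +-congˡ (trans (root-⊗ _ i) (trans (X-cong (eval-root (a ∘ suc)) i) (X-⊕ (act (a ∘ suc) e₀) (X^ k) i))) ⟩
      a zero * e₀ i + (X (act (a ∘ suc) e₀) i + X (X^ k) i)
        ≈⟨ +-assoc _ _ _ ⟨
      (a zero * e₀ i + X (act (a ∘ suc) e₀) i) + X (X^ k) i ∎

    unit : ∀ k → Fin (suc k) → Carrier
    unit zero    i       = 1#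
    unit (suc k) zero    = 0#
    unit (suc k) (suc i) = unit k i

    unit-top : ∀ k → unit k (fromℕ k) ≈ 1#
    unit-top zero    = refl
    unit-top (suc k) = unit-top k

    unit-inject₁ : ∀ k (i : Fin k) → unit k (inject₁ i) ≈ 0#
    unit-inject₁ (suc k) zero    = refl
    unit-inject₁ (suc k) (suc i) = unit-inject₁ k i

    act-unit : ∀ k → act (unit k) e₀ ≋ X^ k
    act-unit zero    i = trans (+-cong (*-identityˡ _) (X-𝟘 i)) (+-identityʳ _)
    act-unit (suc k) i = trans (+-cong (zeroˡ _) (X-cong (act-unit k) i)) (+-identityˡ _)

    X^m : X^ m ≋ unit m
    X^m i = trans (sym (act-unit m i)) (⊗-identityʳ (unit m) i)

    X-unit : ∀ i → X (unit m) i ≈ - c i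
    X-unit i = trans (+-cong (low i) (trans (*-congʳ (unit-top m)) (*-identityˡ _))) (+-identityˡ _)
      where
      low : ∀ j → up (unit m) j ≈ 0#
      low zero    = refl
      low (suc j) = unit-inject₁ m j

    -- The lower terms of c at the root form the vector c itself, while the leading term is X
    -- applied to X^m, that is - c by the choice of `X`; the two cancel.
    root-isRoot : E.eval (λ i → c i • e₀) root ≋ 𝟘
    root-isRoot i = trans (eval-root c i) (trans
      (+-cong (⊗-identityʳ c i) (trans (X-cong X^m i) (X-unit i))) (-‿inverseʳ (c i)))

  -- Composition of homomorphisms and splitting rings.

  idHom : ∀ R → Hom R R
  idHom R = record
    { ⟦_⟧ = λ x → x ; ⟦⟧-cong = λ p → p ; +-homo = λ _ _ → refl ; *-homo = λ _ _ → refl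
    ; 0-homo = refl ; 1-homo = refl }
    where open CommutativeRing R

  infixr 9 _∘ʰ_

  _∘ʰ_ : ∀ {R S T} → Hom S T → Hom R S → Hom R T
  _∘ʰ_ {R} {S} {T} ψ φ = record
    { ⟦_⟧ = λ x → ψ.⟦ φ.⟦ x ⟧ ⟧
    ; ⟦⟧-cong = λ p → ψ.⟦⟧-cong (φ.⟦⟧-cong p)
    ; +-homo = λ x y → trans (ψ.⟦⟧-cong (φ.+-homo x y)) (ψ.+-homo φ.⟦ x ⟧ φ.⟦ y ⟧)
    ; *-homo = λ x y → trans (ψ.⟦⟧-cong (φ.*-homo x y)) (ψ.*-homo φ.⟦ x ⟧ φ.⟦ y ⟧)
    ; 0-homo = trans (ψ.⟦⟧-cong φ.0-homo) ψ.0-homo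
    ; 1-homo = trans (ψ.⟦⟧-cong φ.1-homo) ψ.1-homo }
    where
    module ψ = Hom ψ
    module φ = Hom φ
    open CommutativeRing T

  projection : ∀ R (I : Ideal R) → Hom R (Quotient.quotient R I)
  projection R I = record
    { ⟦_⟧ = λ x → x ; ⟦⟧-cong = ≈⇒~ ; +-homo = λ _ _ → ≈⇒~ refl ; *-homo = λ _ _ → ≈⇒~ refl
    ; 0-homo = ≈⇒~ refl ; 1-homo = ≈⇒~ refl }
    where
    open CommutativeRing R
    open Quotient R I

  module HomProperties {R S : Ring₀} (φ : Hom R S) where
    private
      module R = CommutativeRing R
      module MR = Monic R
      module MS = Monic S
    open CommutativeRing S hiding (zero)
    open RingProps ring using (+-inverseˡ-unique)
    open Hom φ
    open Mult semiring using () renaming (_×_ to _⋆_)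
    open Mult R.semiring using () renaming (_×_ to _⋆ᴿ_)

    ×1-homo : ∀ n → ⟦ n ⋆ᴿ R.1# ⟧ ≈ n ⋆ 1#
    ×1-homo zero    = 0-homo
    ×1-homo (suc n) = trans (+-homo _ _) (+-cong 1-homo (×1-homo n))

    neg-homo : ∀ x → ⟦ R.- x ⟧ ≈ - ⟦ x ⟧
    neg-homo x = +-inverseˡ-unique _ _
      (trans (sym (+-homo (R.- x) x)) (trans (⟦⟧-cong (R.-‿inverseˡ x)) 0-homo))

    eval-homo : ∀ {n} (c : Fin n → R.Carrier) x → ⟦ MR.eval c x ⟧ ≈ MS.eval (λ i → ⟦ c i ⟧) ⟦ x ⟧
    eval-homo {zero}  c x = 1-homo
    eval-homo {suc n} c x = trans (+-homo _ _)
      (+-congˡ (trans (*-homo _ _) (*-congˡ (eval-homo (c ∘ suc) x))))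

    quot-homo : ∀ {n} (c : Fin (suc n) → R.Carrier) x i →
      ⟦ MR.quot c x i ⟧ ≈ MS.quot (λ j → ⟦ c j ⟧) ⟦ x ⟧ i
    quot-homo c x zero    = eval-homo (c ∘ suc) x
    quot-homo c x (suc i) = quot-homo (c ∘ suc) x i

    Splits-homo : ∀ {n} (c a : Fin n → R.Carrier) → MR.Splits c a →
      MS.Splits (λ i → ⟦ c i ⟧) (λ i → ⟦ a i ⟧)
    Splits-homo {zero}  c a s       = refl
    Splits-homo {suc n} c a (r , s) =
      trans (sym (eval-homo c (a zero))) (trans (⟦⟧-cong r) 0-homo) ,
      MS.Splits-cong (λ i → ⟦ a (suc i) ⟧) (quot-homo c (a zero))
        (Splits-homo (MR.quot c (a zero)) (a ∘ suc) s)

  -- Induction on the degree: adjoin one root, divide by the corresponding linear factor, and split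
  -- the quotient over the extension.
  splittingRing : ∀ n (F : FiniteRing) (c : Fin n → FiniteRing.Carrier F) →
    Σ FiniteRing λ S →
    Σ (Hom (FiniteRing.commutativeRing F) (FiniteRing.commutativeRing S)) λ φ →
    Σ (Fin n → FiniteRing.Carrier S) λ a →
    Monic.Splits (FiniteRing.commutativeRing S) (λ i → Hom.⟦ φ ⟧ (c i)) a
  splittingRing zero    F c = F , idHom (FiniteRing.commutativeRing F) , (λ ()) , FiniteRing.refl F
  splittingRing (suc m) F c with splittingRing m extension (E.quot (λ i → c i • e₀) root)
    where open Adjoin F c
  ... | S , ψ , a , s = S , ψ ∘ʰ embed , a⁺ ,
    trans (sym (eval-homo c⁺ root)) (trans (⟦⟧-cong root-isRoot) 0-homo) ,
    MS.Splits-cong a (quot-homo c⁺ root) s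
    where
    open Adjoin F c
    open FiniteRing S hiding (commutativeRing)
    open Hom ψ
    open HomProperties ψ
    module MS = Monic (FiniteRing.commutativeRing S)
    c⁺ : Fin (suc m) → V
    c⁺ i = c i • e₀
    a⁺ : Fin (suc m) → Carrier
    a⁺ zero    = ⟦ root ⟧
    a⁺ (suc i) = a i

  -- Formal derivatives, simple roots and complete lists of roots.

  module Derivative (R : Ring₀) where
    open CommutativeRing R hiding (zero)
    open SetoidReasoning setoid
    open Solver commutativeSemiring using (solve; _:+_; _:*_; _:=_)
    open Monic R public

    deriv : ∀ {n} → (Fin n → Carrier) → Carrier → Carrier
    deriv {zero}  c x = 0#
    deriv {suc n} c x = eval (c ∘ suc) x + x * deriv (c ∘ suc) x

    -- Division with remainder by X - a, and its derivative, with both sides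
    -- moved so that no subtraction occurs.
    eval-quot : ∀ {n} (c : Fin (suc n) → Carrier) a x →
      eval c x + a * eval (quot c a) x ≈ x * eval (quot c a) x + eval c a
    eval-quot {zero}  c a x = solve 4 (λ c x a e → (c :+ x :* e) :+ a :* e := x :* e :+ (c :+ a :* e)) refl (c zero) x a 1#
    eval-quot {suc n} c a x = begin
      (c zero + x * Ex) + a * (Ea + x * Q)
        ≈⟨ solve 6 (λ c x Ex a Ea Q → (c :+ x :* Ex) :+ a :* (Ea :+ x :* Q) := x :* (Ex :+ a :* Q) :+ (c :+ a :* Ea)) refl (c zero) x Ex a Ea Q ⟩
      x * (Ex + a * Q) + (c zero + a * Ea)
        ≈⟨ +-congʳ (*-congˡ (trans (eval-quot (c ∘ suc) a x) (+-comm _ _))) ⟩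
      x * (Ea + x * Q) + (c zero + a * Ea) ∎
      where
      Ex Ea Q : Carrier
      Ex = eval (c ∘ suc) x
      Ea = eval (c ∘ suc) a
      Q  = eval (quot (c ∘ suc) a) x

    deriv-quot : ∀ {n} (c : Fin (suc n) → Carrier) a x →
      deriv c x + a * deriv (quot c a) x ≈ eval (quot c a) x + x * deriv (quot c a) x
    deriv-quot {zero}  c a x = trans (+-congˡ (zeroʳ a)) (+-identityʳ _)
    deriv-quot {suc n} c a x = begin
      (Ex + x * E′) + a * (Q + x * Q′)
        ≈⟨ solve 6 (λ Ex x E′ a Q Q′ → (Ex :+ x :* E′) :+ a :* (Q :+ x :* Q′) := (Ex :+ a :* Q) :+ x :* (E′ :+ a :* Q′)) refl Ex x E′ a Q Q′ ⟩
      (Ex + a * Q) + x * (E′ + a * Q′)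
        ≈⟨ +-cong (trans (eval-quot (c ∘ suc) a x) (+-comm _ _)) (*-congˡ (deriv-quot (c ∘ suc) a x)) ⟩
      (Ea + x * Q) + x * (Q + x * Q′) ∎
      where
      Ex Ea E′ Q Q′ : Carrier
      Ex = eval (c ∘ suc) x
      Ea = eval (c ∘ suc) a
      E′ = deriv (c ∘ suc) x
      Q  = eval (quot (c ∘ suc) a) x
      Q′ = deriv (quot (c ∘ suc) a) x

    Separable : ∀ {n} → (Fin n → Carrier) → Set
    Separable c = ∀ x → eval c x ≈ 0# → ¬ deriv c x ≈ 0#

  NoZeroDivisors : Ring₀ → Set
  NoZeroDivisors R = ∀ {x y} → x * y ≈ 0# → x ≈ 0# ⊎ y ≈ 0#
    where open CommutativeRing R

  module Roots (R : Ring₀) (noZeroDivisors : NoZeroDivisors R) where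
    open CommutativeRing R hiding (zero)
    open RingProps ring
    open SetoidReasoning setoid
    open Derivative R

    cancel-difference : ∀ {x y z} → x * z ≈ y * z → x ≈ y ⊎ z ≈ 0#
    cancel-difference {x} {y} {z} p
      with noZeroDivisors {x - y} {z} (trans ([y-z]x≈yx-zx z x y) (x≈y⇒x∙y⁻¹≈ε p))
    ... | inj₁ q = inj₁ (x∙y⁻¹≈ε⇒x≈y x y q)
    ... | inj₂ q = inj₂ q

    module _ {n} (c : Fin (suc n) → Carrier) {a : Carrier} (r : eval c a ≈ 0#) where

      eval-factor : ∀ x → eval c x + a * eval (quot c a) x ≈ x * eval (quot c a) x
      eval-factor x = trans (eval-quot c a x) (trans (+-congˡ r) (+-identityʳ _))

      quot-root⇒root : ∀ {x} → eval (quot c a) x ≈ 0# → eval c x ≈ 0#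
      quot-root⇒root {x} p = begin
        eval c x                           ≈⟨ +-identityʳ _ ⟨
        eval c x + 0#                      ≈⟨ +-congˡ (trans (*-congˡ p) (zeroʳ a)) ⟨
        eval c x + a * eval (quot c a) x   ≈⟨ eval-factor x ⟩
        x * eval (quot c a) x              ≈⟨ trans (*-congˡ p) (zeroʳ x) ⟩
        0#                                 ∎

      root⇒quot-root : ∀ {x} → eval c x ≈ 0# → x ≈ a ⊎ eval (quot c a) x ≈ 0#
      root⇒quot-root {x} p = cancel-difference
        (sym (trans (sym (trans (+-congʳ p) (+-identityˡ _))) (eval-factor x)))

      -- With Q the quotient, c′ = Q + (X - a)Q′, so a common zero of Q and Q′ is a common zero of c
      -- and c′.
      quot-separable : Separable c → Separable (quot c a)
      quot-separable sep x p q = sep x (quot-root⇒root p) (begin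
        deriv c x                            ≈⟨ +-identityʳ _ ⟨
        deriv c x + 0#                       ≈⟨ +-congˡ (trans (*-congˡ q) (zeroʳ a)) ⟨
        deriv c x + a * deriv (quot c a) x   ≈⟨ deriv-quot c a x ⟩
        eval (quot c a) x + x * deriv (quot c a) x ≈⟨ +-cong p (trans (*-congˡ q) (zeroʳ x)) ⟩
        0# + 0#                              ≈⟨ +-identityˡ 0# ⟩
        0#                                   ∎)

      -- At a the identity c′ = Q + (X - a)Q′ reads c′(a) = Q(a).
      separable⇒simple : Separable c → ¬ eval (quot c a) a ≈ 0#
      separable⇒simple sep p = sep a r (+-cancelʳ (a * deriv (quot c a) a) _ _
        (trans (deriv-quot c a a) (+-congʳ p)))

    splits⇒root : ∀ {n} (c a : Fin n → Carrier) → Splits c a → ∀ i → eval c (a i) ≈ 0#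
    splits⇒root c a (r , s) zero    = r
    splits⇒root c a (r , s) (suc i) = quot-root⇒root c r (splits⇒root (quot c (a zero)) (a ∘ suc) s i)

    module _ (1≉0 : ¬ 1# ≈ 0#) where

      -- Without zero divisors, a root not equal to the first listed one is a root of the quotient;
      -- the descent ends at the constant 1, which has no root.
      root⇒listed : ∀ {n} (c a : Fin n → Carrier) → Splits c a → ∀ {x} → eval c x ≈ 0# → ∃ λ i → x ≈ a i
      root⇒listed {zero}  c a s       p = ⊥-elim (1≉0 p)
      root⇒listed {suc n} c a (r , s) p with root⇒quot-root c r p
      ... | inj₁ x≈a = zero , x≈a
      ... | inj₂ p′ with root⇒listed (quot c (a zero)) (a ∘ suc) s p′
      ...   | i , x≈a = suc i , x≈a

    -- A repetition would make the earlier root a zero of the quotient by its own linear factor,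
    -- hence a multiple root.
    roots-distinct : ∀ {n} (c a : Fin n → Carrier) → Splits c a → Separable c → ∀ i j → a i ≈ a j → i ≡ j
    roots-distinct c a s sep zero zero _ = ≡.refl
    roots-distinct c a (r , s) sep zero (suc j) e = ⊥-elim (separable⇒simple c r sep
      (trans (eval-cong {c = quot c (a zero)} (λ _ → refl) e) (splits⇒root (quot c (a zero)) (a ∘ suc) s j)))
    roots-distinct c a (r , s) sep (suc i) zero e = ⊥-elim (separable⇒simple c r sep
      (trans (eval-cong {c = quot c (a zero)} (λ _ → refl) (sym e)) (splits⇒root (quot c (a zero)) (a ∘ suc) s i)))
    roots-distinct c a (r , s) sep (suc i) (suc j) e = ≡.cong suc
      (roots-distinct (quot c (a zero)) (a ∘ suc) s (quot-separable c r sep) i j e)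

  -- Binomial coefficients modulo p and the Frobenius map.

  prime∤! : ∀ {p} → Prime p → ∀ {k} → k ℕ.< p → ¬ p ℕᵈ.∣ k !
  prime∤! pp {zero}  k<p d = ℕₚ.<⇒≱ (ℕ.nonTrivial⇒n>1 _ {{prime⇒nonTrivial pp}}) (ℕᵈ.∣⇒≤ d)
  prime∤! pp {suc k} k<p d with euclidsLemma (suc k) (k !) pp d
  ... | inj₁ d′ = ℕₚ.<⇒≱ k<p (ℕᵈ.∣⇒≤ d′)
  ... | inj₂ d′ = prime∤! pp (ℕₚ.<-trans (ℕₚ.n<1+n k) k<p) d′

  -- The prime p divides p! = (p C k) · k! · (p - k)!, but neither factorial, as both are of numbers
  -- below p.
  prime∣C : ∀ {p} → Prime p → ∀ {k} → 0 ℕ.< k → k ℕ.< p → p ℕᵈ.∣ p C k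
  prime∣C {p@(suc p-1)} pp {k} 0<k k<p
    with euclidsLemma (p C k) (k ! ℕ.* (p ℕ.∸ k) !) pp (≡.subst (p ℕᵈ.∣_) (≡.sym C*k![p∸k]!≡p!) (ℕᵈ.m∣m*n (p-1 !)))
    where
    instance
      nz : ℕ.NonZero (k ! ℕ.* (p ℕ.∸ k) !)
      nz = k !* (p ℕ.∸ k) !≢0
    C*k![p∸k]!≡p! : (p C k) ℕ.* (k ! ℕ.* (p ℕ.∸ k) !) ≡ p !
    C*k![p∸k]!≡p! = ≡.trans (≡.cong (ℕ._* (k ! ℕ.* (p ℕ.∸ k) !)) (nCk≡n!/k![n-k]! (ℕₚ.<⇒≤ k<p)))
      (ℕᵈᵐ.m/n*n≡m (k![n∸k]!∣n! (ℕₚ.<⇒≤ k<p)))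
  ... | inj₁ d = d
  ... | inj₂ d with euclidsLemma (k !) ((p ℕ.∸ k) !) pp d
  ...   | inj₁ d′ = ⊥-elim (prime∤! pp k<p d′)
  ...   | inj₂ d′ = ⊥-elim (prime∤! pp (ℕₚ.∸-monoʳ-< 0<k (ℕₚ.<⇒≤ k<p)) d′)

  CharDivides : Ring₀ → ℕ → Set
  CharDivides R n = n ⋆ 1# ≈ 0#
    where
    open CommutativeRing R
    open Mult semiring using () renaming (_×_ to _⋆_)

  module Frobenius (R : Ring₀) {p : ℕ} (pp : Prime p) (char : CharDivides R p) where
    open CommutativeRing R hiding (zero)
    open Mult semiring using () renaming (_×_ to _⋆_)
    open SetoidReasoning setoid
    open Exp commutativeSemiring using (_^_; ^-congˡ; ^-assocʳ)
    open Mult semiring using (×-assoc-*; ×-congʳ; ×-assocˡ; ×-congˡ)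
    open Sum semiring using (sum; sum-cong-≋; sum-replicate-zero; sum-init-last)
    open BinomialTheorem commutativeSemiring using (binomialTerm) renaming (theorem to binomialTheorem)

    n×0 : ∀ n → n ⋆ 0# ≈ 0#
    n×0 zero    = refl
    n×0 (suc n) = trans (+-identityˡ _) (n×0 n)

    ∣⇒×≈0 : ∀ {n} → p ℕᵈ.∣ n → ∀ x → n ⋆ x ≈ 0#
    ∣⇒×≈0 {n} (ℕᵈ.divides k ≡.refl) x = begin
      (k ℕ.* p) ⋆ x          ≈⟨ ×-assocˡ x k p ⟨
      k ⋆ (p ⋆ x)            ≈⟨ ×-congʳ k (trans (×-congʳ p (sym (*-identityˡ x))) (sym (×-assoc-* p 1# x))) ⟩
      k ⋆ ((p ⋆ 1#) * x)     ≈⟨ ×-congʳ k (trans (*-congʳ char) (zeroˡ x)) ⟩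
      k ⋆ 0#                 ≈⟨ n×0 k ⟩
      0#                     ∎

    -- All binomial terms except the first and the last have a coefficient divisible by p.
    +-^p : ∀ x y → (x + y) ^ p ≈ x ^ p + y ^ p
    +-^p x y = split p ≡.refl
      where
      middle : ∀ n → suc n ≡ p → (i : Fin n) → binomialTerm x y (suc n) (suc (inject₁ i)) ≈ 0#
      middle n ≡.refl i = ∣⇒×≈0 (prime∣C pp (s≤s z≤n)
        (s≤s (≡.subst (ℕ._< n) (≡.sym (Finₚ.toℕ-inject₁ i)) (Finₚ.toℕ<n i)))) _
      last-term : ∀ n → binomialTerm x y (suc n) (suc (fromℕ n)) ≈ x ^ suc n
      last-term n rewrite Finₚ.toℕ-fromℕ n | nCn≡1 (suc n) | ℕₚ.n∸n≡0 n = trans (+-identityʳ _) (*-identityʳ _)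
      first-term : ∀ n → binomialTerm x y (suc n) zero ≈ y ^ suc n
      first-term n = trans (×-congˡ (nC0 n)) (trans (+-identityʳ _) (*-identityˡ _))
        where
        nC0 : ∀ n → suc n C 0 ≡ 1
        nC0 n = ≡.refl
      split : ∀ n → n ≡ p → (x + y) ^ n ≈ x ^ n + y ^ n
      split zero    e = ⊥-elim (ℕ.≢-nonZero⁻¹ p {{prime⇒nonZero pp}} (≡.sym e))
      split (suc n) e = begin
        (x + y) ^ suc n                                   ≈⟨ binomialTheorem (suc n) x y ⟩
        t zero + sum (t ∘ suc)                            ≈⟨ +-cong (first-term n) (sum-init-last (t ∘ suc)) ⟩
        y ^ suc n + (sum (t ∘ suc ∘ inject₁) + t (suc (fromℕ n)))
          ≈⟨ +-congˡ (+-cong (trans (sum-cong-≋ (middle n e)) (sum-replicate-zero n)) (last-term n)) ⟩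
        y ^ suc n + (0# + x ^ suc n)                      ≈⟨ +-congˡ (+-identityˡ _) ⟩
        y ^ suc n + x ^ suc n                             ≈⟨ +-comm _ _ ⟩
        x ^ suc n + y ^ suc n                             ∎
        where
        t : Fin (suc (suc n)) → Carrier
        t = binomialTerm x y (suc n)

    +-^p^ : ∀ k x y → (x + y) ^ (p ℕ.^ k) ≈ x ^ (p ℕ.^ k) + y ^ (p ℕ.^ k)
    +-^p^ zero    x y = trans (*-identityʳ _) (sym (+-cong (*-identityʳ _) (*-identityʳ _)))
    +-^p^ (suc k) x y = begin
      (x + y) ^ (p ℕ.* p ℕ.^ k)                         ≈⟨ ^-assocʳ (x + y) p (p ℕ.^ k) ⟨
      ((x + y) ^ p) ^ (p ℕ.^ k)                         ≈⟨ ^-congˡ (p ℕ.^ k) (+-^p x y) ⟩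
      (x ^ p + y ^ p) ^ (p ℕ.^ k)                       ≈⟨ +-^p^ k (x ^ p) (y ^ p) ⟩
      (x ^ p) ^ (p ℕ.^ k) + (y ^ p) ^ (p ℕ.^ k)         ≈⟨ +-cong (^-assocʳ x p (p ℕ.^ k)) (^-assocʳ y p (p ℕ.^ k)) ⟩
      x ^ (p ℕ.* p ℕ.^ k) + y ^ (p ℕ.* p ℕ.^ k)         ∎

  -- The polynomial X^q - X, its roots and the polarity on them.

  module Fermat (R : Ring₀) where
    open CommutativeRing R hiding (zero)
    open RingProps ring
    open SetoidReasoning setoid
    open Derivative R
    open Exp commutativeSemiring using (_^_)
    open Mult semiring using (×-comm-*) renaming (_×_ to _⋆_)

    -- X^(2+r) - X
    fermat : ∀ r → Fin (suc (suc r)) → Carrier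
    fermat r zero          = 0#
    fermat r (suc zero)    = - 1#
    fermat r (suc (suc i)) = 0#

    eval-monomial : ∀ r x → eval {r} (const 0#) x ≈ x ^ r
    eval-monomial zero    x = refl
    eval-monomial (suc r) x = trans (+-identityˡ _) (*-congˡ (eval-monomial r x))

    -- The additional factor x avoids the exponent r - 1.
    deriv-monomial : ∀ r x → x * deriv {r} (const 0#) x ≈ r ⋆ (x ^ r)
    deriv-monomial zero    x = zeroʳ x
    deriv-monomial (suc r) x = begin
      x * (eval {r} (const 0#) x + x * deriv {r} (const 0#) x)
        ≈⟨ distribˡ x _ _ ⟩
      x * eval {r} (const 0#) x + x * (x * deriv {r} (const 0#) x)
        ≈⟨ +-cong (*-congˡ (eval-monomial r x)) (trans (*-congˡ (deriv-monomial r x)) (×-comm-* r x (x ^ r))) ⟩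
      x ^ suc r + r ⋆ (x ^ suc r) ∎

    eval-fermat : ∀ r x → eval (fermat r) x + x ≈ x ^ (2 ℕ.+ r)
    eval-fermat r x = begin
      (0# + x * (- 1# + x * e)) + x      ≈⟨ +-congʳ (+-identityˡ _) ⟩
      x * (- 1# + x * e) + x             ≈⟨ +-congʳ (distribˡ x _ _) ⟩
      (x * - 1# + x * (x * e)) + x       ≈⟨ +-congʳ (+-comm _ _) ⟩
      (x * (x * e) + x * - 1#) + x       ≈⟨ +-assoc _ _ _ ⟩
      x * (x * e) + (x * - 1# + x)       ≈⟨ +-congˡ (+-congʳ (trans (*-comm _ _) (-1*x≈-x x))) ⟩
      x * (x * e) + (- x + x)            ≈⟨ +-congˡ (-‿inverseˡ x) ⟩
      x * (x * e) + 0#                   ≈⟨ +-identityʳ _ ⟩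
      x * (x * e)                        ≈⟨ *-congˡ (*-congˡ (eval-monomial r x)) ⟩
      x ^ (2 ℕ.+ r)                      ∎
      where
      e : Carrier
      e = eval {r} (const 0#) x

    deriv-fermat : ∀ r x → deriv (fermat r) x ≈ - 1# + (2 ℕ.+ r) ⋆ (x ^ suc r)
    deriv-fermat r x = begin
      (- 1# + x * e) + x * (e + x * d)         ≈⟨ +-assoc _ _ _ ⟩
      - 1# + (x * e + x * (e + x * d))         ≈⟨ +-congˡ (+-congˡ (distribˡ x e _)) ⟩
      - 1# + (x * e + (x * e + x * (x * d)))   ≈⟨ +-congˡ (+-cong xe (+-cong xe (trans (*-congˡ (deriv-monomial r x)) (×-comm-* r x (x ^ r))))) ⟩
      - 1# + (2 ℕ.+ r) ⋆ (x ^ suc r)           ∎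
      where
      e d : Carrier
      e = eval {r} (const 0#) x
      d = deriv {r} (const 0#) x
      xe : x * e ≈ x ^ suc r
      xe = *-congˡ (eval-monomial r x)

  -- polar a b c stands for ac - b: the points (a , b) and (c , polar a b c) are polar.
  record Polarity (q : ℕ) : Set where
    field
      polar       : Fin q → Fin q → Fin q → Fin q
      polar-sym   : ∀ a b c → polar c (polar a b c) a ≡ b
      polar-joint : ∀ {a a′} b b′ {c c′} → polar a b c ≡ polar a′ b′ c → polar a b c′ ≡ polar a′ b′ c′ →
                    a ≡ a′ ⊎ c ≡ c′

  -- Over the residue field constructed below, this is the subfield of q = 2 + r elements, numbered
  -- by `Fin q`.
  record ListedRoots (R : Ring₀) (r : ℕ) : Set where
    open CommutativeRing R hiding (zero)
    open Exp commutativeSemiring using (_^_)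
    field
      α        : Fin (2 ℕ.+ r) → Carrier
      α-inj    : ∀ i j → α i ≈ α j → i ≡ j
      α-fixed  : ∀ i → α i ^ (2 ℕ.+ r) ≈ α i
      listed   : ∀ {x} → x ^ (2 ℕ.+ r) ≈ x → ∃ λ i → x ≈ α i

  Additive : Ring₀ → ℕ → Set
  Additive R n = ∀ x y → (x + y) ^ n ≈ x ^ n + y ^ n
    where
    open CommutativeRing R
    open Exp commutativeSemiring using (_^_)

  module _ (R : Ring₀) (noZeroDivisors : NoZeroDivisors R) {r : ℕ} (L : ListedRoots R r)
    (+-^q : Additive R (2 ℕ.+ r)) where
    open CommutativeRing R hiding (zero)
    open Exp commutativeSemiring using (_^_)
    open RingProps ring
    open SetoidReasoning setoid
    open Exp commutativeSemiring using (^-congˡ; ^-distrib-*)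
    open ListedRoots L
    open Roots R noZeroDivisors using (cancel-difference)

    private
      q : ℕ
      q = 2 ℕ.+ r

    -- Additivity is applied to the sum (z - y) + y, so that no power of - 1 has to be computed.
    fixed-minus : ∀ {y z} → y ^ q ≈ y → z ^ q ≈ z → (z - y) ^ q ≈ z - y
    fixed-minus {y} {z} fy fz = +-cancelʳ y _ _ (begin
      (z - y) ^ q + y        ≈⟨ +-congˡ fy ⟨
      (z - y) ^ q + y ^ q    ≈⟨ +-^q (z - y) y ⟨
      ((z - y) + y) ^ q      ≈⟨ ^-congˡ q (//-rightDividesˡ y z) ⟩
      z ^ q                  ≈⟨ fz ⟩
      z                      ≈⟨ //-rightDividesˡ y z ⟨
      (z - y) + y            ∎)

    listed-pole : ∀ a b c → ∃ λ d → α a * α c - α b ≈ α d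
    listed-pole a b c = listed (fixed-minus (α-fixed b)
      (trans (^-distrib-* (α a) (α c) q) (*-cong (α-fixed a) (α-fixed c))))

    pole : Fin q → Fin q → Fin q → Fin q
    pole a b c = proj₁ (listed-pole a b c)

    pole-spec : ∀ a b c → α (pole a b c) + α b ≈ α a * α c
    pole-spec a b c = trans (+-congʳ (sym (proj₂ (listed-pole a b c)))) (//-rightDividesˡ (α b) _)

    +≈+⇒-≈- : ∀ {u v w x} → u + v ≈ w + x → u - x ≈ w - v
    +≈+⇒-≈- {u} {v} {w} {x} e = +-cancelʳ (x + v) _ _ (begin
      (u - x) + (x + v)   ≈⟨ +-assoc _ _ _ ⟨
      ((u - x) + x) + v   ≈⟨ +-congʳ (//-rightDividesˡ x u) ⟩
      u + v               ≈⟨ e ⟩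
      w + x               ≈⟨ +-congʳ (//-rightDividesˡ v w) ⟨
      ((w - v) + v) + x   ≈⟨ +-assoc _ _ _ ⟩
      (w - v) + (v + x)   ≈⟨ +-congˡ (+-comm v x) ⟩
      (w - v) + (x + v)   ∎)

    -- The four incidences combine to (a - a′)(c - c′) = 0: two lines with different slopes share at
    -- most one point.
    pole-joint : ∀ {a a′} b b′ {c c′} → pole a b c ≡ pole a′ b′ c → pole a b c′ ≡ pole a′ b′ c′ →
      a ≡ a′ ⊎ c ≡ c′
    pole-joint {a} {a′} b b′ {c} {c′} e e′ = Sum⊎.map (α-inj a a′)
      (λ p → α-inj c c′ (x∙y⁻¹≈ε⇒x≈y _ _ p)) (cancel-difference differences)
      where
      open import Algebra.Properties.CommutativeSemigroup +-commutativeSemigroup using (interchange)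
      cross : α a * α c + α a′ * α c′ ≈ α a′ * α c + α a * α c′
      cross = begin
        α a * α c + α a′ * α c′
          ≈⟨ +-cong (pole-spec a b c) (pole-spec a′ b′ c′) ⟨
        (α (pole a b c) + α b) + (α (pole a′ b′ c′) + α b′)
          ≈⟨ +-cong (+-congʳ (reflexive (≡.cong α e))) (+-congʳ (reflexive (≡.cong α (≡.sym e′)))) ⟩
        (α (pole a′ b′ c) + α b) + (α (pole a b c′) + α b′)
          ≈⟨ interchange _ _ _ _ ⟩
        (α (pole a′ b′ c) + α (pole a b c′)) + (α b + α b′)
          ≈⟨ +-congˡ (+-comm _ _) ⟩
        (α (pole a′ b′ c) + α (pole a b c′)) + (α b′ + α b)
          ≈⟨ interchange _ _ _ _ ⟩
        (α (pole a′ b′ c) + α b′) + (α (pole a b c′) + α b)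
          ≈⟨ +-cong (pole-spec a′ b′ c) (pole-spec a b c′) ⟩
        α a′ * α c + α a * α c′ ∎
      differences : α a * (α c - α c′) ≈ α a′ * (α c - α c′)
      differences = begin
        α a * (α c - α c′)            ≈⟨ x[y-z]≈xy-xz _ _ _ ⟩
        α a * α c - α a * α c′        ≈⟨ +≈+⇒-≈- cross ⟩
        α a′ * α c - α a′ * α c′      ≈⟨ x[y-z]≈xy-xz _ _ _ ⟨
        α a′ * (α c - α c′)           ∎

    polarity : Polarity q
    polarity = record
      { polar = pole
      ; polar-sym = λ a b c → α-inj _ _ (+-cancelʳ (α (pole a b c)) _ _
          (trans (pole-spec c (pole a b c) a) (trans (*-comm _ _) (trans (sym (pole-spec a b c)) (+-comm _ _)))))
      ; polar-joint = pole-joint }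

  ×1-ℤ : ∀ n → Mult._×_ (CommutativeRing.semiring ℤₚ.+-*-commutativeRing) n (ℤ.+ 1) ≡ ℤ.+ n
  ×1-ℤ zero    = ≡.refl
  ×1-ℤ (suc n) = ≡.cong (λ z → ℤ.+ 1 ℤ.+ z) (×1-ℤ n)

  ℤmod-char : ∀ p (2≤p : 2 ℕ.≤ p) → CharDivides (FiniteRing.commutativeRing (ℤmod p 2≤p)) p
  ℤmod-char p@(suc _) 2≤p = trans {Mult._×_ semiring p 1#} { Mult._×_ (CommutativeRing.semiring ℤₚ.+-*-commutativeRing) p (ℤ.+ 1)} {0#}
    (sym {Mult._×_ (CommutativeRing.semiring ℤₚ.+-*-commutativeRing) p (ℤ.+ 1)} {Mult._×_ semiring p 1#}
      (HomProperties.×1-homo (projection ℤₚ.+-*-commutativeRing (multiples (ℤ.+ p))) p))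
    (≡.subst (λ z → (ℤ.+ p) ℤᵈ.∣ z ℤ.- (ℤ.+ 0)) (≡.sym (×1-ℤ p))
      (≡.subst ((ℤ.+ p) ℤᵈ.∣_) (≡.sym (ℤₚ.+-identityʳ (ℤ.+ p))) ℤᵈ.∣-refl))
    where open FiniteRing (ℤmod p 2≤p)

  module SplitFermat (E : Ring₀) (noZeroDivisors : NoZeroDivisors E) {p k r : ℕ} (pp : Prime p) (1≤k : 1 ℕ.≤ k)
    (q≡p^k : 2 ℕ.+ r ≡ p ℕ.^ k) where
    open CommutativeRing E hiding (zero)
    open RingProps ring
    open Exp commutativeSemiring using (_^_)
    open Fermat E
    open Derivative E
    open Roots E noZeroDivisors

    p∣q : p ℕᵈ.∣ 2 ℕ.+ r
    p∣q = ≡.subst (p ℕᵈ.∣_) (≡.sym q≡p^k) (p∣p^ 1≤k)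
      where
      p∣p^ : ∀ {k} → 1 ℕ.≤ k → p ℕᵈ.∣ p ℕ.^ k
      p∣p^ {suc k} _ = ℕᵈ.m∣m*n (p ℕ.^ k)

    module _ (1≉0 : ¬ 1# ≈ 0#) (char : CharDivides E p) (a : Fin (2 ℕ.+ r) → Carrier) (splits : Splits (fermat r) a) where
      open Frobenius E pp char

      separable : Separable (fermat r)
      separable x _ d = 1≉0 (trans (sym (-‿involutive 1#)) (trans (-‿cong -1≈0) -0#≈0#))
        where
        -1≈0 : - 1# ≈ 0#
        -1≈0 = trans (sym (trans (deriv-fermat r x) (trans (+-congˡ (∣⇒×≈0 p∣q (x ^ suc r))) (+-identityʳ _)))) d

      roots : ListedRoots E r
      roots = record
        { α = a
        ; α-inj = roots-distinct (fermat r) a splits separable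
        ; α-fixed = λ i → trans (sym (eval-fermat r (a i)))
            (trans (+-congʳ (splits⇒root (fermat r) a splits i)) (+-identityˡ _))
        ; listed = λ {x} e → root⇒listed 1≉0 (fermat r) a splits
            (+-cancelʳ x _ _ (trans (eval-fermat r x) (trans e (sym (+-identityˡ x))))) }

      fermat-polarity : Polarity (2 ℕ.+ r)
      fermat-polarity = polarity E noZeroDivisors roots
        (≡.subst (Additive E) (≡.sym q≡p^k) (+-^p^ k))

  -- The residue field of the splitting ring.

  module ResidueField (S : FiniteRing) (M : Maximal.ProperIdeal S) (decided : ∀ a → Maximal.Decided S M a) where
    open Maximal S
    private
      module S = FiniteRing S

    E : Ring₀
    E = Quotient.quotient S.commutativeRing (ProperIdeal.ideal M)

    open CommutativeRing E hiding (zero)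

    x-0≈x : ∀ x → (x S.- S.0#) S.≈ x
    x-0≈x x = S.trans (S.+-congˡ (RingProps.-0#≈0# S.ring)) (S.+-identityʳ x)

    noZeroDivisors : NoZeroDivisors E
    noZeroDivisors {x} {y} xy≈0 with decided x
    ... | inj₁ m       = inj₁ (ProperIdeal.Mem-resp M (S.sym (x-0≈x x)) m)
    ... | inj₂ (s , m) = inj₂ (trans (sym (*-identityˡ y)) (trans (*-congʳ {y} {1#} {s * x} m)
      (trans (*-assoc s x y) (trans (*-congˡ {s} xy≈0) (zeroʳ s)))))

    1≉0 : ¬ 1# ≈ 0#
    1≉0 e = ProperIdeal.proper M (ProperIdeal.Mem-resp M (x-0≈x S.1#) e)

  fermat-homo : ∀ {R S} (φ : Hom R S) r i →
    CommutativeRing._≈_ S (Hom.⟦ φ ⟧ (Fermat.fermat R r i)) (Fermat.fermat S r i)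
  fermat-homo φ r zero          = Hom.0-homo φ
  fermat-homo {S = S} φ r (suc zero) =
    trans (HomProperties.neg-homo φ _) (-‿cong (Hom.1-homo φ))
    where open CommutativeRing S
  fermat-homo φ r (suc (suc i)) = Hom.0-homo φ

  -- Splitting and characteristic p are both preserved by homomorphisms. They therefore pass from
  -- ℤ/p and the splitting ring to the residue field, where there are no zero divisors.
  primePower-polarity : ∀ r → IsPrimePower (2 ℕ.+ r) → Polarity (2 ℕ.+ r)
  primePower-polarity r (p , k , pp , 1≤k , q≡p^k) = residual (splittingRing (2 ℕ.+ r) F (Fermat.fermat FR r))
    where
    2≤p : 2 ℕ.≤ p
    2≤p = ℕ.nonTrivial⇒n>1 p {{prime⇒nonTrivial pp}}

    F : FiniteRing
    F = ℤmod p 2≤p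

    FR : Ring₀
    FR = FiniteRing.commutativeRing F

    residual : (Σ FiniteRing λ S → Σ (Hom FR (FiniteRing.commutativeRing S)) λ φ →
      Σ (Fin (2 ℕ.+ r) → FiniteRing.Carrier S) λ a →
      Monic.Splits (FiniteRing.commutativeRing S) (λ i → Hom.⟦ φ ⟧ (Fermat.fermat FR r i)) a) → Polarity (2 ℕ.+ r)
    residual (S , φ , a , splits) with Maximal.maximal S
    ... | M , decided = SplitFermat.fermat-polarity E noZeroDivisors {k = k} pp 1≤k q≡p^k 1≉0
      (trans (sym (HomProperties.×1-homo ψ p)) (trans (Hom.⟦⟧-cong ψ (ℤmod-char p 2≤p)) (Hom.0-homo ψ)))
      a (Monic.Splits-cong E a (fermat-homo ψ r)
          (HomProperties.Splits-homo π (λ i → Hom.⟦ φ ⟧ (Fermat.fermat FR r i)) a splits))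
      where
      open ResidueField S M decided
      open CommutativeRing E
      π : Hom (FiniteRing.commutativeRing S) E
      π = projection (FiniteRing.commutativeRing S) (Maximal.ProperIdeal.ideal M)
      ψ : Hom FR E
      ψ = π ∘ʰ φ

module Graphs where

  open import Data.Empty using (⊥)
  open import Data.Bool using (true)
  import Data.Bool.Properties as Boolₚ
  open import Data.Fin as Fin using (Fin; zero; suc; toℕ; fromℕ<; combine; remQuot; punchIn; punchOut)
  import Data.Fin.Properties as Finₚ
  open import Data.List using (allFin; filter)
  open import Data.List.Membership.Propositional using (_∈_)
  import Data.List.Membership.Propositional.Properties as ∈ₚ
  import Data.List.Membership.Setoid.Properties as ∈ˢₚ
  import Data.List.Relation.Unary.Any as Any
  open import Data.Nat as ℕ using (ℕ; zero; suc; z≤n; s≤s; _≤_; _<_; _+_; _*_; ∣_-_∣)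
  import Data.Nat.Properties as ℕₚ
  open import Data.Product using (Σ; ∃; _×_; _,_; proj₁; proj₂)
  open import Data.Product.Properties using (≡-dec)
  open import Data.Sum using (_⊎_; inj₁; inj₂)
  open import Function using (_∘_)
  open import Relation.Nullary using (¬_; Dec; yes; no; does; contradiction)
  open import Relation.Nullary.Decidable using (dec-true; dec-false; map′; _×-dec_; _⊎-dec_; ¬?)
  open import Relation.Binary.Definitions using (DecidableEquality)
  open import Relation.Binary.PropositionalEquality as ≡
    using (_≡_; _≢_; refl; trans; cong; subst; subst₂; setoid)
  open import Defs
  open FiniteFields using (Polarity)

  -- Distances, degrees and potentials in finite graphs.

  least : ∀ {P : ℕ → Set} → (∀ n → Dec (P n)) → ∀ k → P k → ∃ λ m → P m × (∀ j → P j → m ≤ j)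
  least P? zero    p = 0 , p , λ _ _ → z≤n
  least P? (suc k) p with P? 0
  ... | yes p₀ = 0 , p₀ , λ _ _ → z≤n
  ... | no ¬p₀ with least (P? ∘ suc) k p
  ...   | m , pm , min = suc m , pm , λ { zero p₀ → contradiction p₀ ¬p₀ ; (suc j) pj → s≤s (min j pj) }

  module _ {n} (G : Graph n) where

    walk? : ∀ k u v → Dec (Walk G u v k)
    walk? zero    u v = map′ (λ { refl → here u }) (λ { (here _) → refl }) (u Finₚ.≟ v)
    walk? (suc k) u v = map′ (λ { (w , a , p) → step a p }) (λ { (step a p) → _ , a , p })
      (Finₚ.any? (λ w → (adj G u w Boolₚ.≟ true) ×-dec walk? k w v))

    -- Walks of a given length are decidable, so a shortest one is found by searching below the
    -- length of a known one.
    connected⇒distance : Connected G → Σ (Fin n → Fin n → ℕ) (IsDistance G)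
    connected⇒distance conn = (λ u v → proj₁ (shortest u v)) , (λ u v → proj₂ (shortest u v))
      where
      shortest : ∀ u v → ∃ λ m → Walk G u v m × (∀ j → Walk G u v j → m ≤ j)
      shortest u v = least (λ k → walk? k u v) _ (proj₂ (conn u v))

    injection⇒≤degree : ∀ {k} v (f : Fin k → Fin n) → (∀ {i j} → f i ≡ f j → i ≡ j) →
      (∀ i → Adj G v (f i)) → k ≤ degree G v
    injection⇒≤degree v f inj adjacent = Finₚ.injective⇒≤ {f = Any.index ∘ member} λ {i} {j} e →
      inj (∈ˢₚ.index-injective (setoid (Fin n)) (member i) (member j) e)
      where
      member : ∀ i → f i ∈ filter (λ w → adj G v w Boolₚ.≟ true) (allFin n)
      member i = ∈ₚ.∈-filter⁺ (λ w → adj G v w Boolₚ.≟ true) (∈ₚ.∈-allFin (f i)) (adjacent i)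

    Adj-sym : ∀ {u v} → Adj G u v → Adj G v u
    Adj-sym {u} {v} = trans (Graph.sym G v u)

    infixr 5 _++ʷ_
    _++ʷ_ : ∀ {u v w k l} → Walk G u v k → Walk G v w l → Walk G u w (k + l)
    here _   ++ʷ q = q
    step a p ++ʷ q = step a (p ++ʷ q)

    reverseʷ : ∀ {u v k} → Walk G u v k → Walk G v u k
    reverseʷ (here v)           = here v
    reverseʷ {u} {v} (step {k = k} a p) = subst (Walk G v u) (ℕₚ.+-comm k 1) (reverseʷ p ++ʷ step (Adj-sym a) (here u))

    potential-bound : (φ : Fin n → ℕ) → (∀ {u v} → Adj G u v → φ v ≤ suc (φ u)) →
      ∀ {u v k} → Walk G u v k → φ v ≤ k + φ u
    potential-bound φ lip (here v) = ℕₚ.≤-refl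
    potential-bound φ lip {u} {v} (step {v = w} {k = k} a p) = ℕₚ.≤-trans (potential-bound φ lip p)
      (ℕₚ.≤-trans (ℕₚ.+-monoʳ-≤ k (lip a)) (ℕₚ.≤-reflexive (ℕₚ.+-suc k (φ u))))

  module Triples (K A B : ℕ) where

    -- The bracketing K * (A * B) makes the block number of a vertex its `quotient` by the block
    -- order A * B; this lets sums over vertices collapse to sums over blocks.
    encode : Fin K × (Fin A × Fin B) → Fin (K * (A * B))
    encode (i , (k , b)) = combine i (combine k b)

    decode : Fin (K * (A * B)) → Fin K × (Fin A × Fin B)
    decode v = let (i , x) = remQuot {K} (A * B) v in i , remQuot B x

    decode-encode : ∀ v → decode (encode v) ≡ v
    decode-encode (i , (k , b)) = trans
      (cong (λ (j , x) → j , remQuot B x) (Finₚ.remQuot-combine {K} {A * B} i (combine k b)))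
      (cong (i ,_) (Finₚ.remQuot-combine {A} {B} k b))

    encode-decode : ∀ v → encode (decode v) ≡ v
    encode-decode v = trans
      (cong (combine (proj₁ (remQuot {K} (A * B) v))) (Finₚ.combine-remQuot {A} B (proj₂ (remQuot {K} (A * B) v))))
      (Finₚ.combine-remQuot {K} (A * B) v)

  -- A single block of the chain.

  module Block {s : ℕ} (P : Polarity (3 + s)) where
    open Polarity P

    q : ℕ
    q = 3 + s

    pattern 0F = zero
    pattern 1F = suc zero
    pattern 2F = suc (suc zero)

    -- (zero , m) is the point at infinity of slope m, (suc a , b) is the
    -- affine point (a , b).
    Point : Set
    Point = Fin (suc q) × Fin q

    _≟ᵖ_ : DecidableEquality Point
    _≟ᵖ_ = ≡-dec Finₚ._≟_ Finₚ._≟_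

    -- The potential on the columns. Together with the values 0 and 4 at the slopes 0 and 1 and 2 at
    -- the other slopes, it puts every slope within 1 of its own column.
    height : Fin q → ℕ
    height 0F            = 1
    height 1F            = 3
    height (suc (suc _)) = 2

    level : Point → ℕ
    level (suc a , b)            = height a
    level (zero , 0F)            = 0
    level (zero , 1F)            = 4
    level (zero , suc (suc _))   = 2

    -- This fails exactly between the columns 0 and 1, whose heights are 1 and 3. Phrasing the
    -- deletion through heights builds the Lipschitz property into adjacency.
    Near : Fin q → Fin q → Set
    Near a c = height a ≤ suc (height c) × height c ≤ suc (height a)

    -- The polarity graph with the absolute point at infinity removed and, through
    -- Near, without the edges between the columns 0F and 1F.
    _—_ : Point → Point → Set
    (zero , m)  — (zero , m′)  = ⊥
    (zero , m)  — (suc a , b)  = m ≡ a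
    (suc a , b) — (zero , m)   = m ≡ a
    (suc a , b) — (suc c , d)  = d ≡ polar a b c × ¬ (a ≡ c × b ≡ d) × Near a c

    _—?_ : ∀ x y → Dec (x — y)
    (zero , m)  —? (zero , m′)  = no (λ ())
    (zero , m)  —? (suc a , b)  = m Finₚ.≟ a
    (suc a , b) —? (zero , m)   = m Finₚ.≟ a
    (suc a , b) —? (suc c , d)  = (d Finₚ.≟ polar a b c) ×-dec
      (¬? ((a Finₚ.≟ c) ×-dec (b Finₚ.≟ d))) ×-dec
      ((height a ℕₚ.≤? suc (height c)) ×-dec (height c ℕₚ.≤? suc (height a)))

    polar-flip : ∀ {a b c d} → d ≡ polar a b c → b ≡ polar c d a
    polar-flip {a} {b} {c} refl = ≡.sym (polar-sym a b c)

    —-sym : ∀ {x y} → x — y → y — x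
    —-sym {zero , m}  {suc a , b} e = e
    —-sym {suc a , b} {zero , m}  e = e
    —-sym {suc a , b} {suc c , d} (refl , ne , l , r) =
      polar-flip refl , (λ (p , p′) → ne (≡.sym p , ≡.sym p′)) , r , l

    —-irrefl : ∀ {x} → ¬ x — x
    —-irrefl {suc a , b} (_ , ne , _) = ne (refl , refl)

    -- Deletions create no 4-cycle, so the polarity alone decides. No two slopes are adjacent, and
    -- the cases differ in which vertices are slopes; only four affine points call for
    -- `polar-joint`.
    —-common : ∀ {w x y z} → w — x → x — y → y — z → z — w → w ≡ y ⊎ x ≡ z
    —-common {zero , _}  {suc _ , _} {zero , _}  {suc _ , _} refl refl _ _ = inj₁ refl
    —-common {zero , m}  {suc _ , b} {suc c , d} {suc _ , b′} refl (e , _) (e′ , _) refl =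
      inj₂ (cong (suc m ,_) (trans (polar-flip e) (≡.sym e′)))
    —-common {suc a , b} {suc c , d} {zero , _}  {suc _ , d′} (e , _) refl refl (e′ , _) =
      inj₂ (cong (suc c ,_) (trans e (≡.sym (polar-flip e′))))
    —-common {suc a , b} {zero , _}  {suc _ , b′} {zero , _} refl refl refl refl = inj₂ refl
    —-common {suc a , b} {zero , _}  {suc _ , b′} {suc c , d} refl refl (e , _) (e′ , _) =
      inj₁ (cong (suc a ,_) (trans e′ (≡.sym (polar-flip e))))
    —-common {suc a , b} {suc c , d} {suc _ , b′} {zero , _} (e , _) (e′ , _) refl refl =
      inj₁ (cong (suc a ,_) (trans (polar-flip e) (≡.sym e′)))
    —-common {suc a , b} {suc c , d} {suc a′ , b′} {suc c′ , d′} (e₁ , _) (e₂ , _) (e₃ , _) (e₄ , _)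
      with polar-joint b b′ (trans (≡.sym e₁) (polar-flip e₂)) (trans (≡.sym (polar-flip e₄)) e₃)
    -- Two points of the same column with a common polar point coincide.
    ... | inj₁ refl = inj₁ (cong (suc a ,_) (trans (polar-flip e₁) (≡.sym e₂)))
    ... | inj₂ refl = inj₂ (cong (suc c ,_) (trans e₁ (≡.sym (polar-flip e₄))))

    -- Only the columns 0F and 1F have lost edges; elsewhere the value is a dummy
    -- different from the argument.
    opposite : Fin q → Fin q
    opposite 0F            = 1F
    opposite 1F            = 0F
    opposite (suc (suc _)) = 1F

    ≢-opposite : ∀ a → a ≢ opposite a
    ≢-opposite 0F            ()
    ≢-opposite 1F            ()
    ≢-opposite (suc (suc _)) ()

    near : ∀ a c → c ≢ opposite a → Near a c
    near 0F            0F            _ = s≤s z≤n , s≤s z≤n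
    near 0F            1F            n = contradiction refl n
    near 0F            (suc (suc _)) _ = s≤s z≤n , s≤s (s≤s z≤n)
    near 1F            0F            n = contradiction refl n
    near 1F            1F            _ = s≤s (s≤s (s≤s z≤n)) , s≤s (s≤s (s≤s z≤n))
    near 1F            (suc (suc _)) _ = s≤s (s≤s (s≤s z≤n)) , s≤s (s≤s z≤n)
    near (suc (suc _)) 0F            _ = s≤s (s≤s z≤n) , s≤s z≤n
    near (suc (suc _)) 1F            _ = s≤s (s≤s z≤n) , s≤s (s≤s (s≤s z≤n))
    near (suc (suc _)) (suc (suc _)) _ = s≤s (s≤s z≤n) , s≤s (s≤s z≤n)

    near-columns : ∀ {a b c} → a ≢ c → c ≢ opposite a → (suc a , b) — (suc c , polar a b c)
    near-columns {a} {c = c} a≢c n = refl , (λ (p , _) → a≢c p) , near a c n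

    -- An affine point has a neighbour for each first coordinate except possibly its
    -- own, where it may be absolute, and the opposite one, where edges were deleted.
    neighbour : Point → Fin (2 + s) → Point
    neighbour (zero , m)  k = suc m , Fin.inject₁ k
    neighbour (suc a , b) k = column , polar′ column
      module Neighbour where
      suc-≢ : suc a ≢ suc (opposite a)
      suc-≢ e = ≢-opposite a (Finₚ.suc-injective e)
      column : Fin (suc q)
      -- The inner `punchIn` skips the opposite column in the numbering that leaves out column a;
      -- the value zero stands for the point at infinity.
      column = punchIn (suc a) (punchIn (punchOut suc-≢) k)
      polar′ : Fin (suc q) → Fin q
      polar′ zero    = a
      polar′ (suc c) = polar a b c
      column≢suc : column ≢ suc a
      column≢suc = Finₚ.punchInᵢ≢i (suc a) _
      column≢opposite : column ≢ suc (opposite a)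
      column≢opposite e = Finₚ.punchInᵢ≢i (punchOut suc-≢) k
        (Finₚ.punchIn-injective (suc a) _ _ (trans e (≡.sym (Finₚ.punchIn-punchOut suc-≢))))
      adjacent : ∀ c → c ≢ suc a → c ≢ suc (opposite a) → (suc a , b) — (c , polar′ c)
      adjacent zero    _ _ = refl
      adjacent (suc c) p n = near-columns (λ e → p (cong suc (≡.sym e))) (λ e → n (cong suc e))

    neighbour-— : ∀ x k → x — neighbour x k
    neighbour-— (zero , m)  k = refl
    neighbour-— (suc a , b) k = adjacent column column≢suc column≢opposite
      where open Neighbour a b k

    neighbour-injective : ∀ x {k l} → neighbour x k ≡ neighbour x l → k ≡ l
    neighbour-injective (zero , m)  e = Finₚ.inject₁-injective (cong proj₂ e)
    neighbour-injective (suc a , b) e =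
      -- The argument zero is a dummy: the skipped columns do not depend on the index of the
      -- neighbour.
      Finₚ.punchIn-injective (punchOut (suc-≢ zero)) _ _ (Finₚ.punchIn-injective (suc a) _ _ (cong proj₁ e))
      where open Neighbour a b

    level-lipschitz : ∀ {x y} → x — y → level y ≤ suc (level x)
    level-lipschitz {zero , 0F}            {suc _ , _} refl = s≤s z≤n
    level-lipschitz {zero , 1F}            {suc _ , _} refl = s≤s (s≤s (s≤s z≤n))
    level-lipschitz {zero , suc (suc _)}   {suc _ , _} refl = s≤s (s≤s z≤n)
    level-lipschitz {suc _ , _} {zero , 0F}            refl = z≤n
    level-lipschitz {suc _ , _} {zero , 1F}            refl = s≤s (s≤s (s≤s (s≤s z≤n)))
    level-lipschitz {suc _ , _} {zero , suc (suc _)}   refl = s≤s (s≤s z≤n)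
    level-lipschitz {suc _ , _} {suc _ , _} (_ , _ , _ , r) = r

    level≤4 : ∀ x → level x ≤ 4
    level≤4 (zero , 0F)            = z≤n
    level≤4 (zero , 1F)            = s≤s (s≤s (s≤s (s≤s z≤n)))
    level≤4 (zero , suc (suc _))   = s≤s (s≤s z≤n)
    level≤4 (suc 0F , _)            = s≤s z≤n
    level≤4 (suc 1F , _)            = s≤s (s≤s (s≤s z≤n))
    level≤4 (suc (suc (suc _)) , _) = s≤s (s≤s z≤n)

    source target : Point
    source = zero , 0F
    target = zero , 1F

  -- The chain of blocks: no 4-cycles, degrees and distances.

  module Chain {s : ℕ} (P : Polarity (3 + s)) (K : ℕ) where
    open Block P

    Vertex : Set
    Vertex = Fin K × Point

    Link : Vertex → Vertex → Set
    Link (i , x) (j , y) = toℕ j ≡ suc (toℕ i) × x ≡ target × y ≡ source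

    _~_ : Vertex → Vertex → Set
    u ~ v = (proj₁ u ≡ proj₁ v × proj₂ u — proj₂ v) ⊎ (Link u v ⊎ Link v u)

    link? : ∀ u v → Dec (Link u v)
    link? (i , x) (j , y) = (toℕ j ℕₚ.≟ suc (toℕ i)) ×-dec (x ≟ᵖ target) ×-dec (y ≟ᵖ source)

    _~?_ : ∀ u v → Dec (u ~ v)
    u ~? v = ((proj₁ u Finₚ.≟ proj₁ v) ×-dec (proj₂ u —? proj₂ v)) ⊎-dec (link? u v ⊎-dec link? v u)

    ~-sym : ∀ {u v} → u ~ v → v ~ u
    ~-sym (inj₁ (e , a))  = inj₁ (≡.sym e , —-sym a)
    ~-sym (inj₂ (inj₁ l)) = inj₂ (inj₂ l)
    ~-sym (inj₂ (inj₂ l)) = inj₂ (inj₁ l)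

    ~-irrefl : ∀ {v} → ¬ v ~ v
    ~-irrefl (inj₁ (_ , a))         = —-irrefl a
    ~-irrefl (inj₂ (inj₁ (e , _)))  = ℕₚ.1+n≢n (≡.sym e)
    ~-irrefl (inj₂ (inj₂ (e , _)))  = ℕₚ.1+n≢n (≡.sym e)

    -- A vertex lies on at most one link: `target` links only forwards and `source` only backwards.
    -- Any other edge at an end of a link stays in its block.
    link-next : ∀ {a b d} → Link a b → a ~ d → b ≢ d → proj₁ a ≡ proj₁ d
    link-next _ (inj₁ (e , _)) _ = e
    link-next (e , refl , refl) (inj₂ (inj₁ (e′ , _ , refl))) b≢d =
      contradiction (cong (_, source) (Finₚ.toℕ-injective (trans e (≡.sym e′)))) b≢d
    link-next (_ , refl , _) (inj₂ (inj₂ (_ , _ , ())))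

    link-prev : ∀ {a b c} → Link a b → b ~ c → a ≢ c → proj₁ b ≡ proj₁ c
    link-prev _ (inj₁ (e , _)) _ = e
    link-prev (_ , _ , refl) (inj₂ (inj₁ (_ , () , _)))
    link-prev (e , refl , refl) (inj₂ (inj₂ (e′ , refl , _))) a≢c =
      contradiction (cong (_, target) (Finₚ.toℕ-injective (ℕₚ.suc-injective (trans (≡.sym e) e′)))) a≢c

    -- The cycle edges next to the link a b stay in their blocks, so c d joins the same two blocks
    -- and must be the same link, against a ≢ d.
    link-isBridge : ∀ {a b c d} → Link a b → b ~ c → c ~ d → d ~ a → a ≢ c → b ≢ d → a ≢ d → ⊥
    link-isBridge {a} {b} {c} {d} l@(e , refl , refl) bc cd da a≢c b≢d a≢d
      with link-next l (~-sym da) b≢d | link-prev l bc a≢c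
    ... | refl | refl with cd
    ...   | inj₁ (refl , _)              = ℕₚ.1+n≢n (≡.sym e)
    ...   | inj₂ (inj₁ (e′ , _))         = ℕₚ.<⇒≢ (ℕₚ.m≤n⇒m≤1+n ℕₚ.≤-refl) (trans e′ (cong suc e))
    ...   | inj₂ (inj₂ (_ , refl , _))   = a≢d refl

    -- If some edge is a link, the cycle is rotated or reflected so that the link comes first;
    -- otherwise the whole cycle lies in one block.
    ~-C₄-free : ∀ {a b c d} → a ≢ b → a ≢ c → a ≢ d → b ≢ c → b ≢ d → c ≢ d →
      a ~ b → b ~ c → c ~ d → d ~ a → ⊥
    ~-C₄-free ab ac ad bc bd cd (inj₂ (inj₁ l)) e₂ e₃ e₄ = link-isBridge l e₂ e₃ e₄ ac bd ad
    ~-C₄-free ab ac ad bc bd cd (inj₂ (inj₂ l)) e₂ e₃ e₄ = link-isBridge l (~-sym e₄) (~-sym e₃) (~-sym e₂) bd ac bc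
    ~-C₄-free ab ac ad bc bd cd e₁ (inj₂ (inj₁ l)) e₃ e₄ = link-isBridge l e₃ e₄ e₁ bd (≡.≢-sym ac) (≡.≢-sym ab)
    ~-C₄-free ab ac ad bc bd cd e₁ (inj₂ (inj₂ l)) e₃ e₄ = link-isBridge l (~-sym e₁) (~-sym e₄) (~-sym e₃) (≡.≢-sym ac) bd cd
    ~-C₄-free ab ac ad bc bd cd e₁ e₂ (inj₂ (inj₁ l)) e₄ = link-isBridge l e₄ e₁ e₂ (≡.≢-sym ac) (≡.≢-sym bd) (≡.≢-sym bc)
    ~-C₄-free ab ac ad bc bd cd e₁ e₂ (inj₂ (inj₂ l)) e₄ = link-isBridge l (~-sym e₂) (~-sym e₁) (~-sym e₄) (≡.≢-sym bd) (≡.≢-sym ac) (≡.≢-sym ad)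
    ~-C₄-free ab ac ad bc bd cd e₁ e₂ e₃ (inj₂ (inj₁ l)) = link-isBridge l e₁ e₂ e₃ (≡.≢-sym bd) ac (≡.≢-sym cd)
    ~-C₄-free ab ac ad bc bd cd e₁ e₂ e₃ (inj₂ (inj₂ l)) = link-isBridge l (~-sym e₃) (~-sym e₂) (~-sym e₁) ac (≡.≢-sym bd) ab
    ~-C₄-free ab ac ad bc bd cd (inj₁ (refl , e₁)) (inj₁ (refl , e₂)) (inj₁ (refl , e₃)) (inj₁ (_ , e₄))
      with —-common e₁ e₂ e₃ e₄
    ... | inj₁ refl = ac refl
    ... | inj₂ refl = bd refl

    module Encoded {order : ℕ} (encode : Vertex → Fin order) (decode : Fin order → Vertex)
      (decode-encode : ∀ v → decode (encode v) ≡ v) (encode-decode : ∀ v → encode (decode v) ≡ v) where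

      decode-injective : ∀ {u v} → decode u ≡ decode v → u ≡ v
      decode-injective {u} {v} e = trans (≡.sym (encode-decode u)) (trans (cong encode e) (encode-decode v))

      chain : Graph order
      chain = record
        { adj = λ u v → does (decode u ~? decode v)
        ; sym = λ u v → does-⇔ (decode u ~? decode v) (decode v ~? decode u)
        ; irrefl = λ v → dec-false (decode v ~? decode v) ~-irrefl }
        where
        does-⇔ : ∀ {u v} (p : Dec (u ~ v)) (q : Dec (v ~ u)) → does p ≡ does q
        does-⇔ (yes p) (yes q) = refl
        does-⇔ (yes p) (no ¬q) = contradiction (~-sym p) ¬q
        does-⇔ (no ¬p) (yes q) = contradiction (~-sym q) ¬p
        does-⇔ (no ¬p) (no ¬q) = refl

      Adj⇒~ : ∀ {u v} → Adj chain u v → decode u ~ decode v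
      Adj⇒~ {u} {v} = does⇒ (decode u ~? decode v)
        where
        does⇒ : ∀ {A : Set} (A? : Dec A) → does A? ≡ true → A
        does⇒ (yes a) _ = a

      ~⇒Adj : ∀ {x y} → x ~ y → Adj chain (encode x) (encode y)
      ~⇒Adj {x} {y} p = dec-true (decode (encode x) ~? decode (encode y))
        (subst₂ _~_ (≡.sym (decode-encode x)) (≡.sym (decode-encode y)) p)

      C₄-free : C4Free chain
      C₄-free a b c d ab ac ad bc bd cd (e₁ , e₂ , e₃ , e₄) =
        ~-C₄-free (ab ∘ decode-injective) (ac ∘ decode-injective) (ad ∘ decode-injective)
          (bc ∘ decode-injective) (bd ∘ decode-injective) (cd ∘ decode-injective)
          (Adj⇒~ e₁) (Adj⇒~ e₂) (Adj⇒~ e₃) (Adj⇒~ e₄)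

      minDegree : MinDegreeAtLeast chain (2 + s)
      minDegree v = injection⇒≤degree chain v (λ k → encode (i , neighbour x k))
        (λ e → neighbour-injective x (cong proj₂ (trans (≡.sym (decode-encode _)) (trans (cong decode e) (decode-encode _)))))
        (λ k → subst (λ w → Adj chain w (encode (i , neighbour x k))) (encode-decode v) (~⇒Adj (inj₁ (refl , neighbour-— x k))))
        where
        i : Fin K
        i = proj₁ (decode v)
        x : Point
        x = proj₂ (decode v)

      -- A block accounts for 5: `level` climbs from 0 to 4, and the link from `target` to the next
      -- `source` adds exactly 1.
      potential : Fin order → ℕ
      potential v = 5 * toℕ (proj₁ (decode v)) + level (proj₂ (decode v))

      potential-lipschitz : ∀ {u v} → Adj chain u v → potential v ≤ suc (potential u)
      potential-lipschitz {u} {v} a = lipschitz (Adj⇒~ a)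
        where
        lipschitz : ∀ {x y} → x ~ y → 5 * toℕ (proj₁ y) + level (proj₂ y) ≤ suc (5 * toℕ (proj₁ x) + level (proj₂ x))
        lipschitz {i , x} (inj₁ (refl , e)) = ℕₚ.≤-trans (ℕₚ.+-monoʳ-≤ (5 * toℕ i) (level-lipschitz e)) (ℕₚ.≤-reflexive (ℕₚ.+-suc (5 * toℕ i) _))
        lipschitz {i , _} {j , _} (inj₂ (inj₁ (e , refl , refl))) rewrite e = ℕₚ.≤-reflexive
          (trans (ℕₚ.+-identityʳ _) (trans (ℕₚ.*-suc 5 (toℕ i)) (cong suc (ℕₚ.+-comm 4 (5 * toℕ i)))))
        lipschitz {i , _} {j , _} (inj₂ (inj₂ (e , refl , refl))) rewrite e = ℕₚ.≤-trans
          (ℕₚ.+-monoʳ-≤ (5 * toℕ j) (ℕₚ.n≤1+n 4))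
          (ℕₚ.≤-trans (ℕₚ.≤-reflexive (trans (ℕₚ.+-comm (5 * toℕ j) 5)
            (trans (≡.sym (ℕₚ.*-suc 5 (toℕ j))) (≡.sym (ℕₚ.+-identityʳ _))))) (ℕₚ.n≤1+n _))

      block : Fin order → Fin K
      block v = proj₁ (decode v)

      Within : Vertex → Vertex → ℕ → Set
      Within x y l = ∃ λ k → k ≤ l × Walk chain (encode x) (encode y) k

      edge : ∀ {x y} → x ~ y → Within x y 1
      edge e = 1 , ℕₚ.≤-refl , step (~⇒Adj e) (here _)

      stay : ∀ {x} → Within x x 0
      stay = 0 , z≤n , here _

      infixr 5 _⁀_
      _⁀_ : ∀ {x y z k l} → Within x y k → Within y z l → Within x z (k + l)
      (k , k≤ , p) ⁀ (l , l≤ , r) = k + l , ℕₚ.+-mono-≤ k≤ l≤ , _++ʷ_ chain p r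

      within-sym : ∀ {x y k} → Within x y k → Within y x k
      within-sym (k , k≤ , p) = k , k≤ , reverseʷ chain p

      weaken : ∀ {x y k l} → k ≤ l → Within x y k → Within x y l
      weaken k≤l (k , k≤ , p) = k , ℕₚ.≤-trans k≤ k≤l , p

      column-edge : ∀ {i a b c} → a ≢ c → c ≢ opposite a → Within (i , suc a , b) (i , suc c , Polarity.polar P a b c) 1
      column-edge p n = edge (inj₁ (refl , near-columns p n))

      infinity-edge : ∀ {i a b} → Within (i , suc a , b) (i , zero , a) 1
      infinity-edge = edge (inj₁ (refl , refl))

      -- Column 2 kept its edges to both columns 0 and 1. The route is slope 1, column 1, column 2,
      -- column 0, slope 0.
      across : ∀ i → Within (i , target) (i , source) 4
      across i = within-sym (infinity-edge {b = 0F}) ⁀ column-edge {c = 2F} (λ ()) (λ ())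
        ⁀ column-edge {c = 0F} (λ ()) (λ ()) ⁀ infinity-edge

      to-source : ∀ i x → Within (i , x) (i , source) 5
      to-source i (zero , 0F)          = weaken z≤n stay
      to-source i (zero , 1F)          = weaken (ℕₚ.n≤1+n 4) (across i)
      to-source i (zero , suc (suc m)) = weaken (s≤s (s≤s (s≤s z≤n)))
        (within-sym (infinity-edge {b = 0F}) ⁀ column-edge {c = 0F} (λ ()) (λ ()) ⁀ infinity-edge)
      to-source i (suc 0F , b)            = weaken (s≤s z≤n) infinity-edge
      to-source i (suc 1F , b)            = infinity-edge ⁀ across i
      to-source i (suc (suc (suc a)) , b) = weaken (s≤s (s≤s z≤n))
        (column-edge {c = 0F} (λ ()) (λ ()) ⁀ infinity-edge)

      along : ∀ t {i j} → toℕ j ≡ t + toℕ i → Within (i , source) (j , source) (t * 5)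
      along zero    {i} e rewrite Finₚ.toℕ-injective e = stay
      along (suc t) {i} {j} e = (within-sym (across i) ⁀ edge (inj₂ (inj₁ (Finₚ.toℕ-fromℕ< i+1<K , refl , refl))))
        ⁀ along t (trans e (trans (≡.sym (ℕₚ.+-suc t (toℕ i))) (cong (_+_ t) (≡.sym (Finₚ.toℕ-fromℕ< i+1<K)))))
        where
        i+1<K : suc (toℕ i) < K
        i+1<K = ℕₚ.≤-<-trans (subst (suc (toℕ i) ≤_) (≡.sym e) (s≤s (ℕₚ.m≤n+m (toℕ i) t))) (Finₚ.toℕ<n j)

      -- The 10 pays for two detours of at most 5 each, from x to the source of its block and from
      -- the last source to y.
      within-≤ : ∀ {i j} x y → toℕ i ≤ toℕ j → Within (i , x) (j , y) (5 * ∣ toℕ i - toℕ j ∣ + 10)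
      within-≤ {i} {j} x y i≤j = weaken (ℕₚ.≤-reflexive count)
        (to-source i x ⁀ along (toℕ j ℕ.∸ toℕ i) (≡.sym (ℕₚ.m∸n+n≡m i≤j)) ⁀ within-sym (to-source j y))
        where
        count : 5 + ((toℕ j ℕ.∸ toℕ i) * 5 + 5) ≡ 5 * ∣ toℕ i - toℕ j ∣ + 10
        count rewrite ℕₚ.m≤n⇒∣m-n∣≡n∸m i≤j | ℕₚ.*-comm (toℕ j ℕ.∸ toℕ i) 5 =
          trans (ℕₚ.+-comm 5 _) (ℕₚ.+-assoc (5 * (toℕ j ℕ.∸ toℕ i)) 5 5)

      within : ∀ u v → Within u v (5 * ∣ toℕ (proj₁ u) - toℕ (proj₁ v) ∣ + 10)
      within (i , x) (j , y) with ℕₚ.≤-total (toℕ i) (toℕ j)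
      ... | inj₁ i≤j = within-≤ x y i≤j
      ... | inj₂ j≤i = subst (λ t → Within (i , x) (j , y) (5 * t + 10)) (ℕₚ.∣-∣-comm (toℕ j) (toℕ i))
        (within-sym (within-≤ y x j≤i))

      gap : Fin order → Fin order → ℕ
      gap u v = ∣ toℕ (block u) - toℕ (block v) ∣

      short-walk : ∀ u v → ∃ λ k → k ≤ 5 * gap u v + 10 × Walk chain u v k
      short-walk u v = let (k , k≤ , p) = within (decode u) (decode v) in
        k , k≤ , subst₂ (λ a b → Walk chain a b k) (encode-decode u) (encode-decode v) p

      connected : Connected chain
      connected u v = let (k , _ , p) = short-walk u v in k , p

      -- The potential exceeds 5 times the block number by a `level`, which is at most 4.
      block-bound : ∀ {u v k} → Walk chain u v k → 5 * toℕ (block v) ≤ 5 * toℕ (block u) + (k + 4)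
      block-bound {u} {v} {k} p = begin
        5 * toℕ (block v)               ≤⟨ ℕₚ.m≤m+n _ _ ⟩
        potential v                     ≤⟨ potential-bound chain potential potential-lipschitz p ⟩
        k + (5 * toℕ (block u) + level (proj₂ (decode u)))
                                        ≤⟨ ℕₚ.+-monoʳ-≤ k (ℕₚ.+-monoʳ-≤ (5 * toℕ (block u)) (level≤4 (proj₂ (decode u)))) ⟩
        k + (5 * toℕ (block u) + 4)     ≡⟨ x∙yz≈y∙xz k (5 * toℕ (block u)) 4 ⟩
        5 * toℕ (block u) + (k + 4)     ∎
        where
        open ℕₚ.≤-Reasoning
        open import Algebra.Properties.CommutativeSemigroup ℕₚ.+-commutativeSemigroup using (x∙yz≈y∙xz)

      gap-bound : ∀ {u v k} → Walk chain u v k → 5 * gap u v ≤ k + 4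
      gap-bound {u} {v} {k} p with ℕₚ.≤-total (toℕ (block u)) (toℕ (block v))
      ... | inj₁ u≤v rewrite ℕₚ.m≤n⇒∣m-n∣≡n∸m u≤v | ℕₚ.*-distribˡ-∸ 5 (toℕ (block v)) (toℕ (block u)) =
        ℕₚ.m≤n+o⇒m∸n≤o (5 * toℕ (block v)) (5 * toℕ (block u)) (block-bound p)
      ... | inj₂ v≤u rewrite ℕₚ.m≤n⇒∣n-m∣≡n∸m v≤u | ℕₚ.*-distribˡ-∸ 5 (toℕ (block u)) (toℕ (block v)) =
        ℕₚ.m≤n+o⇒m∸n≤o (5 * toℕ (block u)) (5 * toℕ (block v)) (block-bound (reverseʷ chain p))

module Averages where

  open import Defs using (avgDist; remoteness; proximity)
  open import Data.Nat as ℕ using (ℕ; zero; suc; z≤n; s≤s; _≤_; _+_; _*_; ∣_-_∣; NonZero)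
  import Data.Nat.Properties as ℕₚ
  open import Data.Nat.Tactic.RingSolver using (solve-∀)
  open import Data.Nat.ListAction using (sum)
  open import Data.Fin as Fin using (Fin; zero; suc; toℕ; _↑ˡ_; _↑ʳ_; quotient)
  import Data.Fin.Properties as Finₚ
  open import Data.Integer as ℤ using ()
  import Data.Integer.Properties as ℤₚ
  open import Data.List using (List; []; _∷_; map; foldr; tabulate; allFin)
  open import Data.List.Properties using (map-tabulate)
  open import Data.List.Membership.Propositional using (_∈_)
  import Data.List.Membership.Propositional.Properties as ∈ₚ
  open import Data.List.Relation.Unary.Any using (here; there)
  open import Data.Rational as ℚ using (ℚ; _/_)
  import Data.Rational.Properties as ℚₚ
  open import Data.Rational.Unnormalised as ℚᵘ using (mkℚᵘ)
  import Data.Rational.Unnormalised.Properties as ℚᵘₚ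
  open import Data.Product using (∃; _,_)
  open import Data.Sum using (inj₁; inj₂)
  open import Function using (_∘_; id)
  open import Relation.Binary.PropositionalEquality as ≡ using (_≡_; refl; trans; cong; cong₂; subst)

  -- Sums of distances along a chain.

  ∑ : ∀ {n} → (Fin n → ℕ) → ℕ
  ∑ f = sum (tabulate f)

  sum-allFin : ∀ {n} (f : Fin n → ℕ) → sum (map f (allFin n)) ≡ ∑ f
  sum-allFin f = cong sum (map-tabulate id f)

  ∑-cong : ∀ {n} {f g : Fin n → ℕ} → (∀ i → f i ≡ g i) → ∑ f ≡ ∑ g
  ∑-cong {zero}  p = refl
  ∑-cong {suc n} p = cong₂ _+_ (p zero) (∑-cong (p ∘ suc))

  ∑-mono : ∀ {n} {f g : Fin n → ℕ} → (∀ i → f i ≤ g i) → ∑ f ≤ ∑ g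
  ∑-mono {zero}  p = z≤n
  ∑-mono {suc n} p = ℕₚ.+-mono-≤ (p zero) (∑-mono (p ∘ suc))

  ∑-affine : ∀ {n} a b (f : Fin n → ℕ) → ∑ (λ i → a * f i + b) ≡ a * ∑ f + n * b
  ∑-affine {zero}  a b f = ≡.sym (trans (ℕₚ.+-identityʳ _) (ℕₚ.*-zeroʳ a))
  ∑-affine {suc n} a b f = trans (cong (_+_ (a * f zero + b)) (∑-affine a b (f ∘ suc)))
    (regroup a (f zero) b (∑ (f ∘ suc)) (n * b))
    where
    regroup : ∀ a x b y c → a * x + b + (a * y + c) ≡ a * (x + y) + (b + c)
    regroup = solve-∀

  ∑-const : ∀ n b → ∑ {n} (λ _ → b) ≡ n * b
  ∑-const zero    b = refl
  ∑-const (suc n) b = cong (λ x → b + x) (∑-const n b)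

  ∑-split : ∀ m {n} (f : Fin (m + n) → ℕ) → ∑ f ≡ ∑ (λ i → f (i ↑ˡ n)) + ∑ (λ j → f (m ↑ʳ j))
  ∑-split zero    f = refl
  ∑-split (suc m) f = trans (cong (λ x → f zero + x) (∑-split m (f ∘ suc))) (≡.sym (ℕₚ.+-assoc (f zero) _ _))

  ∑-quotient : ∀ K B (g : Fin K → ℕ) → ∑ {K * B} (λ v → g (quotient {K} B v)) ≡ B * ∑ g
  ∑-quotient zero    B g = ≡.sym (ℕₚ.*-zeroʳ B)
  ∑-quotient (suc K) B g = begin
    ∑ {B + K * B} (λ v → g (quotient {suc K} B v))
      ≡⟨ ∑-split B (λ v → g (quotient {suc K} B v)) ⟩
    ∑ (λ i → g (quotient {suc K} B (i ↑ˡ (K * B)))) + ∑ (λ j → g (quotient {suc K} B (B ↑ʳ j)))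
      ≡⟨ cong₂ _+_ (∑-cong (λ i → cong g (first i))) (∑-cong (λ j → cong g (later j))) ⟩
    ∑ {B} (λ _ → g zero) + ∑ {K * B} (λ j → g (suc (quotient {K} B j)))
      ≡⟨ cong₂ _+_ (∑-const B (g zero)) (∑-quotient K B (g ∘ suc)) ⟩
    B * g zero + B * ∑ (g ∘ suc)
      ≡⟨ ℕₚ.*-distribˡ-+ B (g zero) _ ⟨
    B * ∑ g ∎
    where
    open ≡.≡-Reasoning
    first : ∀ i → quotient {suc K} B (i ↑ˡ (K * B)) ≡ zero
    first i rewrite Finₚ.splitAt-↑ˡ B i (K * B) = refl
    later : ∀ j → quotient {suc K} B (B ↑ʳ j) ≡ suc (quotient {K} B j)
    later j rewrite Finₚ.splitAt-↑ʳ B (K * B) j = refl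

  -- The i blocks on one side and the r blocks on the other contribute a triangular number each;
  -- doubling avoids halves. Induction removes the first block.
  ∑-gap : ∀ i r → 2 * ∑ {suc (i + r)} (λ j → ∣ i - toℕ j ∣) ≡ i * suc i + r * suc r
  ∑-gap zero    zero    = refl
  ∑-gap zero    (suc r) = begin
    2 * ∑ {suc r} (λ j → suc (toℕ j))
      ≡⟨ cong (2 *_) (∑-cong {suc r} (λ j → step (toℕ j))) ⟩
    2 * ∑ {suc r} (λ j → 1 * toℕ j + 1)
      ≡⟨ cong (2 *_) (∑-affine {suc r} 1 1 toℕ) ⟩
    2 * (1 * ∑ {suc r} toℕ + suc r * 1)
      ≡⟨ regroup (∑ {suc r} toℕ) r ⟩
    2 * ∑ {suc r} toℕ + 2 * suc r
      ≡⟨ cong (_+ 2 * suc r) (∑-gap zero r) ⟩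
    r * suc r + 2 * suc r
      ≡⟨ finish r ⟩
    suc r * suc (suc r) ∎
    where
    open ≡.≡-Reasoning
    step : ∀ x → suc x ≡ 1 * x + 1
    step = solve-∀
    regroup : ∀ x r → 2 * (1 * x + suc r * 1) ≡ 2 * x + 2 * suc r
    regroup = solve-∀
    finish : ∀ r → r * suc r + 2 * suc r ≡ suc r * suc (suc r)
    finish = solve-∀
  ∑-gap (suc i) r = trans (ℕₚ.*-distribˡ-+ 2 (suc i) (∑ {suc (i + r)} (λ j → ∣ i - toℕ j ∣)))
    (trans (cong (_+_ (2 * suc i)) (∑-gap i r)) (finish i (r * suc r)))
    where
    finish : ∀ i y → 2 * suc i + (i * suc i + y) ≡ suc i * suc (suc i) + y
    finish = solve-∀

  module _ {i r L : ℕ} (e : i + r ≡ L + L) where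

    -- The two sides differ by 2ir.
    oblong-sum-≤ : i * suc i + r * suc r ≤ (L + L) * suc (L + L)
    oblong-sum-≤ rewrite ≡.sym e = ℕₚ.m+n≤o⇒m≤o _ (ℕₚ.≤-reflexive (square i r))
      where
      square : ∀ i r → (i * suc i + r * suc r) + 2 * (i * r) ≡ (i + r) * suc (i + r)
      square = solve-∀

    -- Writing the two numbers as L - d and L + d, the difference of the two sides is 2d².
    oblong-sum-≥-ordered : i ≤ L → 2 * (L * suc L) ≤ i * suc i + r * suc r
    oblong-sum-≥-ordered i≤L with ℕₚ.m≤n⇒∃[o]m+o≡n i≤L
    ... | d , refl with ℕₚ.+-cancelˡ-≡ i r (i + 2 * d) (trans e (shift i d))
      where
      shift : ∀ i d → (i + d) + (i + d) ≡ i + (i + 2 * d)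
      shift = solve-∀
    ...   | refl = ℕₚ.m+n≤o⇒m≤o _ (ℕₚ.≤-reflexive (square i d))
      where
      square : ∀ i d → 2 * ((i + d) * suc (i + d)) + 2 * (d * d) ≡ i * suc i + (i + 2 * d) * suc (i + 2 * d)
      square = solve-∀

  oblong-sum-≥ : ∀ {i r L} → i + r ≡ L + L → 2 * (L * suc L) ≤ i * suc i + r * suc r
  oblong-sum-≥ {i} {r} {L} e with ℕₚ.≤-total i L
  ... | inj₁ i≤L = oblong-sum-≥-ordered e i≤L
  ... | inj₂ L≤i = subst (2 * (L * suc L) ≤_) (ℕₚ.+-comm (r * suc r) (i * suc i))
    (oblong-sum-≥-ordered (trans (ℕₚ.+-comm r i) e)
      (ℕₚ.+-cancelˡ-≤ L r L (ℕₚ.≤-trans (ℕₚ.+-monoˡ-≤ r L≤i) (ℕₚ.≤-reflexive e))))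

  -- S is the sum of the distances from a vertex in block i of a chain of
  -- K = 2L + 1 blocks of B vertices each, T the sum of ∣ i - j ∣ over the blocks j,
  -- and n₁ = n - 1.
  module Estimates (B-1 L n₁ S T : ℕ) (n≡ : suc (L + L) * suc B-1 ≡ suc n₁)
    (S-upper : S ≤ 5 * (suc B-1 * T) + 10 * (suc (L + L) * suc B-1))
    (S-lower : 5 * (suc B-1 * T) ≤ S + 4 * (suc (L + L) * suc B-1)) where
    open ℕₚ.≤-Reasoning

    private
      B n : ℕ
      B = suc B-1
      n = suc (L + L) * B

      B≤n : B ≤ n
      B≤n = ℕₚ.m≤m+n B _

      n₁≤n : n₁ ≤ n
      n₁≤n = ℕₚ.≤-trans (ℕₚ.n≤1+n n₁) (ℕₚ.≤-reflexive (≡.sym n≡))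

      LB≤n₁ : (L + L) * B ≤ n₁
      LB≤n₁ = ℕₚ.≤-pred (ℕₚ.≤-trans (s≤s (ℕₚ.m≤n+m ((L + L) * B) B-1)) (ℕₚ.≤-reflexive n≡))

    module _ (n≤2n₁ : n ≤ 2 * n₁) where

      -- Errors arise as multiples of n, whereas an average divides by n₁ = n - 1; a factor 2
      -- absorbs the difference.
      nB≤ : ∀ c → c * (n * B) ≤ 2 * c * (B * n₁)
      nB≤ c = ℕₚ.≤-trans (ℕₚ.*-monoʳ-≤ c (ℕₚ.*-monoˡ-≤ B n≤2n₁)) (ℕₚ.≤-reflexive (regroup c B n₁))
        where
        regroup : ∀ c B n₁ → c * (2 * n₁ * B) ≡ 2 * c * (B * n₁)
        regroup = solve-∀

      -- This is S/n₁ ≤ 5n/(2B) + 25 cleared of denominators, as are the three estimates that follow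
      -- in their directions. The main term is 5n(n - B), and n - B ≤ n₁.
      remote-≤ : 2 * T ≤ (L + L) * suc (L + L) → S * (2 * B) ≤ (5 * n + 25 * (2 * B)) * n₁
      remote-≤ h = begin
        S * (2 * B)                                               ≤⟨ ℕₚ.*-monoˡ-≤ (2 * B) S-upper ⟩
        (5 * (B * T) + 10 * n) * (2 * B)                          ≡⟨ expand B T n ⟩
        5 * (B * B) * (2 * T) + 20 * (n * B)                      ≤⟨ ℕₚ.+-monoˡ-≤ _ (ℕₚ.*-monoʳ-≤ (5 * (B * B)) h) ⟩
        5 * (B * B) * ((L + L) * suc (L + L)) + 20 * (n * B)      ≡⟨ cong (_+ 20 * (n * B)) (regroup B (L + L)) ⟩
        5 * n * ((L + L) * B) + 20 * (n * B)                      ≤⟨ ℕₚ.+-mono-≤ (ℕₚ.*-monoʳ-≤ (5 * n) LB≤n₁) (nB≤ 20) ⟩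
        5 * n * n₁ + 40 * (B * n₁)                                ≤⟨ ℕₚ.+-monoʳ-≤ (5 * n * n₁) (ℕₚ.*-monoˡ-≤ (B * n₁) (ℕₚ.m≤m+n 40 10)) ⟩
        5 * n * n₁ + 50 * (B * n₁)                                ≡⟨ collect n B n₁ ⟩
        (5 * n + 25 * (2 * B)) * n₁                               ∎
        where
        expand : ∀ B T n → (5 * (B * T) + 10 * n) * (2 * B) ≡ 5 * (B * B) * (2 * T) + 20 * (n * B)
        expand = solve-∀
        regroup : ∀ B x → 5 * (B * B) * (x * suc x) ≡ 5 * (suc x * B) * (x * B)
        regroup = solve-∀
        collect : ∀ n B n₁ → 5 * n * n₁ + 50 * (B * n₁) ≡ (5 * n + 25 * (2 * B)) * n₁
        collect = solve-∀

      remote-≥ : (L + L) * suc (L + L) ≤ 2 * T → 5 * n * n₁ ≤ (S + 25 * n₁) * (2 * B)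
      remote-≥ h = begin
        5 * n * n₁                                                ≤⟨ ℕₚ.*-monoʳ-≤ (5 * n) n₁≤n ⟩
        5 * n * n                                                 ≡⟨ regroup B (L + L) ⟩
        5 * (B * B) * ((L + L) * suc (L + L)) + 5 * (n * B)       ≤⟨ ℕₚ.+-monoˡ-≤ _ (ℕₚ.*-monoʳ-≤ (5 * (B * B)) h) ⟩
        5 * (B * B) * (2 * T) + 5 * (n * B)                       ≡⟨ cong (_+ 5 * (n * B)) (factor B T) ⟩
        5 * (B * T) * (2 * B) + 5 * (n * B)                       ≤⟨ ℕₚ.+-monoˡ-≤ _ (ℕₚ.*-monoˡ-≤ (2 * B) S-lower) ⟩
        (S + 4 * n) * (2 * B) + 5 * (n * B)                       ≡⟨ expand S n B ⟩
        2 * B * S + 13 * (n * B)                                  ≤⟨ ℕₚ.+-monoʳ-≤ (2 * B * S) (nB≤ 13) ⟩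
        2 * B * S + 26 * (B * n₁)                                 ≤⟨ ℕₚ.+-monoʳ-≤ (2 * B * S) (ℕₚ.*-monoˡ-≤ (B * n₁) (ℕₚ.m≤m+n 26 24)) ⟩
        2 * B * S + 50 * (B * n₁)                                 ≡⟨ collect S B n₁ ⟩
        (S + 25 * n₁) * (2 * B)                                   ∎
        where
        regroup : ∀ B x → 5 * (suc x * B) * (suc x * B) ≡ 5 * (B * B) * (x * suc x) + 5 * ((suc x * B) * B)
        regroup = solve-∀
        factor : ∀ B T → 5 * (B * B) * (2 * T) ≡ 5 * (B * T) * (2 * B)
        factor = solve-∀
        expand : ∀ S n B → (S + 4 * n) * (2 * B) + 5 * (n * B) ≡ 2 * B * S + 13 * (n * B)
        expand = solve-∀
        collect : ∀ S B n₁ → 2 * B * S + 50 * (B * n₁) ≡ (S + 25 * n₁) * (2 * B)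
        collect = solve-∀

      -- Since (2L + 1)² = 4L(L + 1) + 1, the square 5n² exceeds the main term by only 5B².
      proximate-≥ : 2 * (L * suc L) ≤ 2 * T → 5 * n * n₁ ≤ (S + 25 * n₁) * (4 * B)
      proximate-≥ h = begin
        5 * n * n₁                                                ≤⟨ ℕₚ.*-monoʳ-≤ (5 * n) n₁≤n ⟩
        5 * n * n                                                 ≡⟨ regroup B L ⟩
        10 * (B * B) * (2 * (L * suc L)) + 5 * (B * B)            ≤⟨ ℕₚ.+-mono-≤ (ℕₚ.*-monoʳ-≤ (10 * (B * B)) h) (ℕₚ.*-monoʳ-≤ 5 (ℕₚ.*-monoˡ-≤ B B≤n)) ⟩
        10 * (B * B) * (2 * T) + 5 * (n * B)                      ≡⟨ cong (_+ 5 * (n * B)) (factor B T) ⟩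
        5 * (B * T) * (4 * B) + 5 * (n * B)                       ≤⟨ ℕₚ.+-monoˡ-≤ _ (ℕₚ.*-monoˡ-≤ (4 * B) S-lower) ⟩
        (S + 4 * n) * (4 * B) + 5 * (n * B)                       ≡⟨ expand S n B ⟩
        4 * B * S + 21 * (n * B)                                  ≤⟨ ℕₚ.+-monoʳ-≤ (4 * B * S) (nB≤ 21) ⟩
        4 * B * S + 42 * (B * n₁)                                 ≤⟨ ℕₚ.+-monoʳ-≤ (4 * B * S) (ℕₚ.*-monoˡ-≤ (B * n₁) (ℕₚ.m≤m+n 42 58)) ⟩
        4 * B * S + 100 * (B * n₁)                                ≡⟨ collect S B n₁ ⟩
        (S + 25 * n₁) * (4 * B)                                   ∎
        where
        regroup : ∀ B L → 5 * (suc (L + L) * B) * (suc (L + L) * B) ≡ 10 * (B * B) * (2 * (L * suc L)) + 5 * (B * B)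
        regroup = solve-∀
        factor : ∀ B T → 10 * (B * B) * (2 * T) ≡ 5 * (B * T) * (4 * B)
        factor = solve-∀
        expand : ∀ S n B → (S + 4 * n) * (4 * B) + 5 * (n * B) ≡ 4 * B * S + 21 * (n * B)
        expand = solve-∀
        collect : ∀ S B n₁ → 4 * B * S + 100 * (B * n₁) ≡ (S + 25 * n₁) * (4 * B)
        collect = solve-∀

      proximate-≤ : 2 * T ≤ 2 * (L * suc L) → S * (4 * B) ≤ (5 * n + 25 * (4 * B)) * n₁
      proximate-≤ h = begin
        S * (4 * B)                                               ≤⟨ ℕₚ.*-monoˡ-≤ (4 * B) S-upper ⟩
        (5 * (B * T) + 10 * n) * (4 * B)                          ≡⟨ expand B T n ⟩
        10 * (B * B) * (2 * T) + 40 * (n * B)                     ≤⟨ ℕₚ.+-monoˡ-≤ _ (ℕₚ.*-monoʳ-≤ (10 * (B * B)) h) ⟩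
        -- Adding 5B² completes the main term to the square 5n².
        10 * (B * B) * (2 * (L * suc L)) + 40 * (n * B)           ≤⟨ ℕₚ.+-monoˡ-≤ (40 * (n * B)) (ℕₚ.m≤m+n (10 * (B * B) * (2 * (L * suc L))) (5 * (B * B))) ⟩
        10 * (B * B) * (2 * (L * suc L)) + 5 * (B * B) + 40 * (n * B)
                                                                  ≡⟨ cong (_+ 40 * (n * B)) (regroup B L) ⟩
        5 * n * n + 40 * (n * B)                                  ≡⟨ cong (λ x → 5 * n * x + 40 * (n * B)) n≡ ⟩
        5 * n * suc n₁ + 40 * (n * B)                             ≡⟨ cong (_+ 40 * (n * B)) (split n n₁) ⟩
        5 * n * n₁ + 5 * (n * 1) + 40 * (n * B)                   ≤⟨ ℕₚ.+-monoˡ-≤ _ (ℕₚ.+-monoʳ-≤ (5 * n * n₁) (ℕₚ.*-monoʳ-≤ 5 (ℕₚ.*-monoʳ-≤ n (s≤s z≤n)))) ⟩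
        5 * n * n₁ + 5 * (n * B) + 40 * (n * B)                   ≡⟨ merge (5 * n * n₁) (n * B) ⟩
        5 * n * n₁ + 45 * (n * B)                                 ≤⟨ ℕₚ.+-monoʳ-≤ (5 * n * n₁) (nB≤ 45) ⟩
        -- The tightest of the four estimates: an error of 90/4 = 22.5 must fit below the common
        -- constant 25.
        5 * n * n₁ + 90 * (B * n₁)                                ≤⟨ ℕₚ.+-monoʳ-≤ (5 * n * n₁) (ℕₚ.*-monoˡ-≤ (B * n₁) (ℕₚ.m≤m+n 90 10)) ⟩
        5 * n * n₁ + 100 * (B * n₁)                               ≡⟨ collect n B n₁ ⟩
        (5 * n + 25 * (4 * B)) * n₁                               ∎
        where
        expand : ∀ B T n → (5 * (B * T) + 10 * n) * (4 * B) ≡ 10 * (B * B) * (2 * T) + 40 * (n * B)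
        expand = solve-∀
        regroup : ∀ B L → 10 * (B * B) * (2 * (L * suc L)) + 5 * (B * B) ≡ 5 * (suc (L + L) * B) * (suc (L + L) * B)
        regroup = solve-∀
        split : ∀ n n₁ → 5 * n * suc n₁ ≡ 5 * n * n₁ + 5 * (n * 1)
        split = solve-∀
        merge : ∀ x y → x + 5 * y + 40 * y ≡ x + 45 * y
        merge = solve-∀
        collect : ∀ n B n₁ → 5 * n * n₁ + 100 * (B * n₁) ≡ (5 * n + 25 * (4 * B)) * n₁
        collect = solve-∀

  -- Comparison of fractions, and maxima and minima of averages.

  toℚᵘ-/ : ∀ i d → ℚ.toℚᵘ (i / suc d) ℚᵘ.≃ mkℚᵘ i d
  toℚᵘ-/ i d = ℚₚ.toℚᵘ-fromℚᵘ (mkℚᵘ i d)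

  -- Elements of `ℚ` are kept in lowest terms; over the unnormalised rationals the comparison is
  -- plain cross-multiplication.
  /-mono-≤ : ∀ {a b c d} .{{_ : NonZero b}} .{{_ : NonZero d}} → a * d ≤ c * b →
    (ℤ.+ a) / b ℚ.≤ (ℤ.+ c) / d
  /-mono-≤ {a} {suc b} {c} {suc d} h = ℚₚ.toℚᵘ-cancel-≤
    (ℚᵘₚ.≤-respˡ-≃ (ℚᵘₚ.≃-sym (toℚᵘ-/ (ℤ.+ a) b)) (ℚᵘₚ.≤-respʳ-≃ (ℚᵘₚ.≃-sym (toℚᵘ-/ (ℤ.+ c) d))
      (ℚᵘ.*≤* (≡.subst₂ ℤ._≤_ (ℤₚ.pos-* a (suc d)) (ℤₚ.pos-* c (suc b)) (ℤ.+≤+ h)))))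

  /-+ : ∀ a b c .{{_ : NonZero b}} → (ℤ.+ a) / b ℚ.+ (ℤ.+ c) / 1 ≡ (ℤ.+ (a + c * b)) / b
  /-+ a (suc b) c = ℚₚ.toℚᵘ-injective (begin
    ℚ.toℚᵘ ((ℤ.+ a) / suc b ℚ.+ (ℤ.+ c) / 1)
      ≈⟨ ℚₚ.toℚᵘ-homo-+ ((ℤ.+ a) / suc b) ((ℤ.+ c) / 1) ⟩
    ℚ.toℚᵘ ((ℤ.+ a) / suc b) ℚᵘ.+ ℚ.toℚᵘ ((ℤ.+ c) / 1)
      ≈⟨ ℚᵘₚ.+-cong (toℚᵘ-/ (ℤ.+ a) b) (toℚᵘ-/ (ℤ.+ c) 0) ⟩
    mkℚᵘ (ℤ.+ a) b ℚᵘ.+ mkℚᵘ (ℤ.+ c) 0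
      ≈⟨ ℚᵘ.*≡* cross ⟩
    mkℚᵘ (ℤ.+ (a + c * suc b)) b
      ≈⟨ toℚᵘ-/ (ℤ.+ (a + c * suc b)) b ⟨
    ℚ.toℚᵘ ((ℤ.+ (a + c * suc b)) / suc b) ∎)
    where
    open ℚᵘₚ.≃-Reasoning
    cross : ((ℤ.+ a) ℤ.* (ℤ.+ 1) ℤ.+ (ℤ.+ c) ℤ.* (ℤ.+ suc b)) ℤ.* (ℤ.+ suc b) ≡ (ℤ.+ (a + c * suc b)) ℤ.* (ℤ.+ (suc b * 1))
    cross = cong₂ ℤ._*_ (trans (cong₂ ℤ._+_ (ℤₚ.*-identityʳ (ℤ.+ a)) (≡.sym (ℤₚ.pos-* c (suc b)))) (≡.sym (ℤₚ.pos-+ a (c * suc b))))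
      (cong ℤ.+_ (≡.sym (ℕₚ.*-identityʳ (suc b))))

  /-≤-+ : ∀ {a b c d e} .{{_ : NonZero b}} .{{_ : NonZero d}} → a * d ≤ (c + e * d) * b →
    (ℤ.+ a) / b ℚ.≤ (ℤ.+ c) / d ℚ.+ (ℤ.+ e) / 1
  /-≤-+ {a} {b} {c} {d} {e} h = subst ((ℤ.+ a) / b ℚ.≤_) (≡.sym (/-+ c d e)) (/-mono-≤ {a} {b} {c + e * d} {d} h)

  module _ where
    open import Algebra.Properties.AbelianGroup ℚₚ.+-0-abelianGroup using (xyx⁻¹≈y; ⁻¹-anti-homo‿-)

    ≤-+⇒-‿≤ : ∀ x y {C} → x ℚ.≤ y ℚ.+ C → x ℚ.- y ℚ.≤ C
    ≤-+⇒-‿≤ x y {C} p = ℚₚ.≤-trans (ℚₚ.+-monoˡ-≤ (ℚ.- y) p) (ℚₚ.≤-reflexive (xyx⁻¹≈y y C))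

    ∣-∣-≤ : ∀ x y {C} → x ℚ.≤ y ℚ.+ C → y ℚ.≤ x ℚ.+ C → ℚ.∣ x ℚ.- y ∣ ℚ.≤ C
    ∣-∣-≤ x y {C} p r with ℚₚ.∣p∣≡p∨∣p∣≡-p (x ℚ.- y)
    ... | inj₁ e = subst (ℚ._≤ C) (≡.sym e) (≤-+⇒-‿≤ x y p)
    ... | inj₂ e = subst (ℚ._≤ C) (≡.sym (trans e (⁻¹-anti-homo‿- x y))) (≤-+⇒-‿≤ y x r)

  module _ {A : Set} (f : A → ℚ) (e : ℚ) where

    ⊔-fold-≤ : ∀ {c} → e ℚ.≤ c → (∀ v → f v ℚ.≤ c) → ∀ vs → foldr ℚ._⊔_ e (map f vs) ℚ.≤ c
    ⊔-fold-≤ p h []       = p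
    ⊔-fold-≤ p h (v ∷ vs) = ℚₚ.⊔-lub (h v) (⊔-fold-≤ p h vs)

    ≤-⊔-fold : ∀ {v vs} → v ∈ vs → f v ℚ.≤ foldr ℚ._⊔_ e (map f vs)
    ≤-⊔-fold {vs = v ∷ vs} (here refl) = ℚₚ.p≤p⊔q (f v) _
    ≤-⊔-fold {vs = w ∷ vs} (there v∈)  = ℚₚ.≤-trans (≤-⊔-fold v∈) (ℚₚ.p≤q⊔p (f w) _)

    ≤-⊓-fold : ∀ {c} → c ℚ.≤ e → (∀ v → c ℚ.≤ f v) → ∀ vs → c ℚ.≤ foldr ℚ._⊓_ e (map f vs)
    ≤-⊓-fold p h []       = p
    ≤-⊓-fold p h (v ∷ vs) = ℚₚ.⊓-glb (h v) (≤-⊓-fold p h vs)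

    ⊓-fold-≤ : ∀ {v vs} → v ∈ vs → foldr ℚ._⊓_ e (map f vs) ℚ.≤ f v
    ⊓-fold-≤ {vs = v ∷ vs} (here refl) = ℚₚ.p⊓q≤p (f v) _
    ⊓-fold-≤ {vs = w ∷ vs} (there v∈)  = ℚₚ.≤-trans (ℚₚ.p⊓q≤q (f w) _) (⊓-fold-≤ v∈)

  module _ (m : ℕ) (d : Fin (2 + m) → Fin (2 + m) → ℕ) (X C : ℚ) where
    open import Algebra.Properties.AbelianGroup ℚₚ.+-0-abelianGroup using (//-rightDividesˡ; //-rightDividesʳ)

    private
      σ : Fin (2 + m) → ℚ
      σ = avgDist m d

    remoteness-near : (∀ v → σ v ℚ.≤ X ℚ.+ C) → (∃ λ v → X ℚ.≤ σ v ℚ.+ C) →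
      ℚ.∣ remoteness m d ℚ.- X ∣ ℚ.≤ C
    remoteness-near h (v , l) = ∣-∣-≤ (remoteness m d) X
      (⊔-fold-≤ σ (σ zero) (h zero) h (allFin (2 + m)))
      (ℚₚ.≤-trans l (ℚₚ.+-monoˡ-≤ C (≤-⊔-fold σ (σ zero) (∈ₚ.∈-allFin v))))

    proximity-near : (∀ v → X ℚ.≤ σ v ℚ.+ C) → (∃ λ v → σ v ℚ.≤ X ℚ.+ C) →
      ℚ.∣ proximity m d ℚ.- X ∣ ℚ.≤ C
    proximity-near h (v , u) = ∣-∣-≤ (proximity m d) X
      (ℚₚ.≤-trans (⊓-fold-≤ σ (σ zero) (∈ₚ.∈-allFin v)) u)
      (subst (ℚ._≤ proximity m d ℚ.+ C) (//-rightDividesˡ C X)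
        (ℚₚ.+-monoˡ-≤ C (≤-⊓-fold σ (σ zero) (shift zero) shift (allFin (2 + m)))))
      where
      shift : ∀ v → X ℚ.- C ℚ.≤ σ v
      shift v = subst (X ℚ.- C ℚ.≤_) (//-rightDividesʳ C (σ v)) (ℚₚ.+-monoˡ-≤ (ℚ.- C) (h v))

module Chains where

  open import Data.Fin as Fin using (Fin; zero; toℕ; fromℕ<)
  import Data.Fin.Properties as Finₚ
  open import Data.Integer using (+_)
  open import Data.List using (map; allFin)
  open import Data.Nat as ℕ using (ℕ; suc; z≤n; s≤s; _≤_; _+_; _*_)
  import Data.Nat.Properties as ℕₚ
  open import Data.Nat.ListAction using (sum)
  open import Data.Product using (Σ; ∃; _×_; _,_; proj₁; proj₂)
  open import Data.Rational using (ℚ; _/_; _-_; ∣_∣) renaming (_≤_ to _≤ℚ_)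
  open import Relation.Binary.PropositionalEquality as ≡ using (_≡_; refl; trans; cong; cong₂; subst; subst₂)
  open import Defs
  open FiniteFields using (Polarity)
  open Graphs
  open Averages

  -- The chain of 2L + 1 blocks and its average distances.

  module Construction {s : ℕ} (P : Polarity (3 + s)) (L : ℕ) where

    -- By computation, suc B-1 is (4 + s) * (3 + s) and 2 + m is K * suc B-1.
    K B-1 m : ℕ
    K   = suc (L + L)
    B-1 = 2 + s + (3 + s) * (3 + s)
    m   = 1 + s + (3 + s) * (3 + s) + (L + L) * suc B-1

    open Chain P K
    open Triples K (4 + s) (3 + s)
    open Encoded encode decode decode-encode encode-decode

    T : Fin K → ℕ
    T i = ∑ {K} (λ j → ℕ.∣ toℕ i - toℕ j ∣)

    distance : Σ (Fin (2 + m) → Fin (2 + m) → ℕ) (IsDistance chain)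
    distance = connected⇒distance chain connected

    d : Fin (2 + m) → Fin (2 + m) → ℕ
    d = proj₁ distance

    S : Fin (2 + m) → ℕ
    S v = sum (map (d v) (allFin (2 + m)))

    ∑-gap-block : ∀ v → ∑ {2 + m} (gap v) ≡ suc B-1 * T (block v)
    ∑-gap-block v = ∑-quotient K (suc B-1) (λ j → ℕ.∣ toℕ (block v) - toℕ j ∣)

    S-upper : ∀ v → S v ≤ 5 * (suc B-1 * T (block v)) + 10 * (2 + m)
    S-upper v = begin
      S v                                             ≡⟨ sum-allFin (d v) ⟩
      ∑ (d v)                                         ≤⟨ ∑-mono bound ⟩
      ∑ (λ w → 5 * gap v w + 10)                      ≡⟨ ∑-affine 5 10 (gap v) ⟩
      5 * ∑ (gap v) + (2 + m) * 10                    ≡⟨ cong₂ (λ x y → 5 * x + y) (∑-gap-block v) (ℕₚ.*-comm (2 + m) 10) ⟩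
      5 * (suc B-1 * T (block v)) + 10 * (2 + m)      ∎
      where
      open ℕₚ.≤-Reasoning
      bound : ∀ w → d v w ≤ 5 * gap v w + 10
      bound w = let (k , k≤ , p) = short-walk v w in ℕₚ.≤-trans (proj₂ (proj₂ distance v w) k p) k≤

    S-lower : ∀ v → 5 * (suc B-1 * T (block v)) ≤ S v + 4 * (2 + m)
    S-lower v = begin
      5 * (suc B-1 * T (block v))                     ≡⟨ cong (λ x → 5 * x) (∑-gap-block v) ⟨
      5 * ∑ (gap v)                                   ≡⟨ ℕₚ.+-identityʳ _ ⟨
      5 * ∑ (gap v) + 0                               ≡⟨ cong (λ x → 5 * ∑ (gap v) + x) (ℕₚ.*-zeroʳ (2 + m)) ⟨
      5 * ∑ (gap v) + (2 + m) * 0                     ≡⟨ ∑-affine 5 0 (gap v) ⟨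
      ∑ (λ w → 5 * gap v w + 0)                       ≤⟨ ∑-mono bound ⟩
      ∑ (λ w → 1 * d v w + 4)                         ≡⟨ ∑-affine 1 4 (d v) ⟩
      1 * ∑ (d v) + (2 + m) * 4                       ≡⟨ cong₂ _+_ (trans (ℕₚ.*-identityˡ (∑ (d v))) (≡.sym (sum-allFin (d v)))) (ℕₚ.*-comm (2 + m) 4) ⟩
      S v + 4 * (2 + m)                               ∎
      where
      open ℕₚ.≤-Reasoning
      bound : ∀ w → 5 * gap v w + 0 ≤ 1 * d v w + 4
      bound w = subst₂ (λ x y → x ≤ y + 4) (≡.sym (ℕₚ.+-identityʳ (5 * gap v w))) (≡.sym (ℕₚ.*-identityˡ (d v w)))
        (gap-bound (proj₁ (proj₂ distance v w)))

    2T : ∀ i {r} → toℕ i + r ≡ L + L → 2 * T i ≡ toℕ i * suc (toℕ i) + r * suc r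
    2T i {r} e = trans (cong (λ k → 2 * ∑ {suc k} (λ j → ℕ.∣ toℕ i - toℕ j ∣)) (≡.sym e)) (∑-gap (toℕ i) r)

    complement : ∀ (i : Fin K) → ∃ λ r → toℕ i + r ≡ L + L
    complement i = ℕₚ.m≤n⇒∃[o]m+o≡n (Finₚ.toℕ≤pred[n] i)

    2T-≤ : ∀ i → 2 * T i ≤ (L + L) * suc (L + L)
    2T-≤ i = let (r , e) = complement i in subst (_≤ (L + L) * suc (L + L)) (≡.sym (2T i e)) (oblong-sum-≤ {toℕ i} {r} {L} e)

    2T-≥ : ∀ i → 2 * (L * suc L) ≤ 2 * T i
    2T-≥ i = let (r , e) = complement i in subst (2 * (L * suc L) ≤_) (≡.sym (2T i e)) (oblong-sum-≥ {toℕ i} {r} {L} e)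

    -- Block L has exactly L blocks on either side. Any vertex of the two blocks would serve, as the
    -- estimates see only the block number.
    end middle : Fin (2 + m)
    end    = encode (zero , Block.source P)
    middle = encode (fromℕ< (s≤s (ℕₚ.m≤m+n L L)) , Block.source P)

    2T-end : (L + L) * suc (L + L) ≤ 2 * T (block end)
    2T-end = subst (λ i → (L + L) * suc (L + L) ≤ 2 * T i) (≡.sym (cong proj₁ (decode-encode (zero , Block.source P))))
      (ℕₚ.≤-reflexive (≡.sym (2T zero refl)))

    2T-middle : 2 * T (block middle) ≤ 2 * (L * suc L)
    2T-middle = subst (λ i → 2 * T i ≤ 2 * (L * suc L)) (≡.sym (cong proj₁ (decode-encode (i , Block.source P))))
      (ℕₚ.≤-reflexive (trans (2T i (cong (λ x → x + L) i≡L)) (trans (cong (λ x → x * suc x + L * suc L) i≡L)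
        (cong (λ x → L * suc L + x) (≡.sym (ℕₚ.+-identityʳ (L * suc L)))))))
      where
      i : Fin K
      i = fromℕ< (s≤s (ℕₚ.m≤m+n L L))
      i≡L : toℕ i ≡ L
      i≡L = Finₚ.toℕ-fromℕ< (s≤s (ℕₚ.m≤m+n L L))

    n≤2n₁ : 2 + m ≤ 2 * suc m
    n≤2n₁ = ℕₚ.≤-trans (ℕₚ.≤-reflexive (cong suc (ℕₚ.+-comm 1 m))) (s≤s (ℕₚ.+-monoʳ-≤ m (s≤s z≤n)))

    module At (v : Fin (2 + m)) = Estimates B-1 L (suc m) (S v) (T (block v)) refl (S-upper v) (S-lower v)

    C : ℚ
    C = (+ 25) / 1

    remoteness-bound : ∣ remoteness m d - (+ (5 * (2 + m))) / (2 * suc B-1) ∣ ≤ℚ C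
    remoteness-bound = remoteness-near m d _ C
      (λ v → /-≤-+ {S v} {suc m} {5 * (2 + m)} {2 * suc B-1} {25} (At.remote-≤ v n≤2n₁ (2T-≤ (block v))))
      (end , /-≤-+ {5 * (2 + m)} {2 * suc B-1} {S end} {suc m} {25} (At.remote-≥ end n≤2n₁ 2T-end))

    proximity-bound : ∣ proximity m d - (+ (5 * (2 + m))) / (4 * suc B-1) ∣ ≤ℚ C
    proximity-bound = proximity-near m d _ C
      (λ v → /-≤-+ {5 * (2 + m)} {4 * suc B-1} {S v} {suc m} {25} (At.proximate-≥ v n≤2n₁ (2T-≥ (block v))))
      (middle , /-≤-+ {S middle} {suc m} {5 * (2 + m)} {4 * suc B-1} {25} (At.proximate-≤ middle n≤2n₁ 2T-middle))

    L≤n : L ≤ 2 + m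
    L≤n = ℕₚ.≤-trans (ℕₚ.≤-trans (ℕₚ.m≤m+n L L) (ℕₚ.n≤1+n (L + L))) (ℕₚ.m≤m*n K (suc B-1))

    result : Σ ℕ λ m → L ≤ 2 + m × Σ (Graph (2 + m)) λ G →
      Connected G × C4Free G × MinDegreeAtLeast G (2 + s) ×
      Σ (Fin (2 + m) → Fin (2 + m) → ℕ) λ d → IsDistance G d ×
      ∣ remoteness m d - (+ (5 * (2 + m))) / (2 * suc B-1) ∣ ≤ℚ C ×
      ∣ proximity m d - (+ (5 * (2 + m))) / (4 * suc B-1) ∣ ≤ℚ C
    result = m , L≤n , chain , connected , C₄-free , minDegree , d , proj₂ distance , remoteness-bound , proximity-bound

open import Defs
open import Data.Nat using (ℕ; suc; _+_; _*_; _≤_; s≤s)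
open import Data.Fin using (Fin)
open import Data.Product using (Σ; _×_; _,_)
open import Data.Integer using (+_)
open import Data.Rational using (ℚ; _/_; _-_; ∣_∣) renaming (_≤_ to _≤ℚ_)
open import Data.Nat.Properties using (+-comm)
open import Data.Nat.Tactic.RingSolver using (solve-∀)
open import Relation.Binary.PropositionalEquality using (_≡_; subst)

theorem5p6 : (δ : ℕ) → 3 ≤ δ → IsPrimePower (δ + 1) →
    Σ ℚ λ C → (N : ℕ) → Σ ℕ λ m → N ≤ 2 + m × Σ (Graph (2 + m)) λ G →
    Connected G × C4Free G × MinDegreeAtLeast G δ ×
    Σ (Fin (2 + m) → Fin (2 + m) → ℕ) λ d → IsDistance G d ×
    ∣ remoteness m d - (+ (5 * (2 + m))) / (2 * suc (δ * δ + 3 * δ + 1)) ∣ ≤ℚ C ×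
    ∣ proximity m d - (+ (5 * (2 + m))) / (4 * suc (δ * δ + 3 * δ + 1)) ∣ ≤ℚ C
-- With δ = 2 + s there are q = 3 + s field elements. Taking L = N makes the order at least N.
theorem5p6 (suc (suc s)) (s≤s (s≤s _)) pp = (+ 25) / 1 , λ N →
  subst (Result N) (blockOrder s) (Chains.Construction.result (FiniteFields.primePower-polarity (suc s) (subst IsPrimePower (+-comm (2 + s) 1) pp)) N)
  where
  Result : ℕ → ℕ → Set
  Result N B-1 = Σ ℕ λ m → N ≤ 2 + m × Σ (Graph (2 + m)) λ G →
    Connected G × C4Free G × MinDegreeAtLeast G (2 + s) ×
    Σ (Fin (2 + m) → Fin (2 + m) → ℕ) λ d → IsDistance G d ×
    ∣ remoteness m d - (+ (5 * (2 + m))) / (2 * suc B-1) ∣ ≤ℚ (+ 25) / 1 ×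
    ∣ proximity m d - (+ (5 * (2 + m))) / (4 * suc B-1) ∣ ≤ℚ (+ 25) / 1
  -- Both sides are one less than the block order (q + 1)q = (δ + 2)(δ + 1).
  blockOrder : ∀ s → 2 + s + (3 + s) * (3 + s) ≡ (2 + s) * (2 + s) + 3 * (2 + s) + 1
  blockOrder = solve-∀
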